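{- Let $p,q,r$ be pairwise distinct primes with $p<q$ and $p<r$, and write $\Phi_{pqr}(x)=\sum_{n}a_{pqr}(n)x^n$. Put $A_+=\max_n a_{pqr}(n)$ and $A_-=\min_n a_{pqr}(n)$. Let $q',r'\in\{1,\dots,p-1\}$ be the inverses of $q$ and $r$ modulo $p$, let $\alpha=\min\{q',r',p-q',p-r'\}$, and let $\beta$ be the unique integer with $0<\beta<p$ and $\alpha\beta qr\equiv 1 \pmod p$. Then $$A_+\le \min\{2\alpha+\beta,\;p-\beta\},\qquad -A_-\le \min\{p+2\alpha-\beta,\;\beta\}.$$
   Context: $\Phi_{pqr}(x)=\prod_{0<k<pqr,\ \gcd(k,pqr)=1}(x-\zeta^k)$, where $\zeta$ is a primitive $pqr$-th root of unity, is the ternary cyclotomic polynomial; $a_{pqr}(n)$ denotes its coefficient of $x^n$ (zero for $n$ outside $[0,\deg\Phi_{pqr}]$). -}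

module Defs where

open import Algebra.Apartness.Bundles using (HeytingField; HeytingCommutativeRing)
open import Algebra.Bundles using (CommutativeRing; Semiring)
import Algebra.Definitions.RawSemiring as RawSemiringDefs
open import Data.Integer as ℤ using (ℤ; +_; -[1+_])
import Data.Integer.Divisibility as ℤ-Div
open import Data.List using (List; []; _∷_; map; foldr; filter; upTo)
open import Data.Nat as ℕ using (ℕ; zero; suc)
open import Data.Nat.GCD using (gcd)
import Data.Nat.Properties as ℕₚ
open import Data.Product using (_×_; ∃-syntax)
import Level
open import Relation.Binary.PropositionalEquality using (_≡_)
open import Relation.Nullary.Decidable using (_×-dec_)

infix 4 _≡_[mod_]

_≡_[mod_] : ℕ → ℕ → ℕ → Set
x ≡ y [mod m ] = + m ℤ-Div.∣ (+ x ℤ.- + y)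

record IsInverseMod (p x x′ : ℕ) : Set where
  field
    positive : 0 ℕ.< x′
    below    : x′ ℕ.< p
    inverse  : x ℕ.* x′ ≡ 1 [mod p ]

IsMaxOf : (ℕ → ℤ) → ℤ → Set
IsMaxOf a A = (∃[ n ] a n ≡ A) × (∀ n → a n ℤ.≤ A)

IsMinOf : (ℕ → ℤ) → ℤ → Set
IsMinOf a A = (∃[ n ] a n ≡ A) × (∀ n → A ℤ.≤ a n)

totatives : ℕ → List ℕ
totatives n = filter (λ k → (0 ℕₚ.<? k) ×-dec (gcd k n ℕₚ.≟ 1)) (upTo n)

-- The library has no complex numbers, so roots of unity live in an arbitrary
-- field of characteristic zero.  In a Heyting field x # y means that x - y is
-- invertible; it is the constructive form of x ≠ y.
module _ {c ℓ₁ ℓ₂} (K : HeytingField c ℓ₁ ℓ₂) where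

  open HeytingField K

  private
    module R = CommutativeRing
      (HeytingCommutativeRing.commutativeRing heytingCommutativeRing)
    module P = RawSemiringDefs (Semiring.rawSemiring R.semiring)

  CharacteristicZero : Set ℓ₂
  CharacteristicZero = ∀ n → (suc n P.× 1#) # 0#

  fromℤ : ℤ → Carrier
  fromℤ (+ n)    = n P.× 1#
  fromℤ -[1+ n ] = - (suc n P.× 1#)

  record IsPrimitiveRoot (n : ℕ) (ζ : Carrier) : Set (ℓ₁ Level.⊔ ℓ₂) where
    field
      ζⁿ≈1 : (ζ P.^ n) ≈ 1#
      ζᵏ#1 : ∀ k → 0 ℕ.< k → k ℕ.< n → (ζ P.^ k) # 1#

  -- Coefficient lists, constant term first; trailing zeros are allowed.
  Poly : Set c
  Poly = List Carrier

  coeff : Poly → ℕ → Carrier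
  coeff []       _       = 0#
  coeff (x ∷ _)  zero    = x
  coeff (_ ∷ xs) (suc n) = coeff xs n

  _+ᵖ_ : Poly → Poly → Poly
  []       +ᵖ ys       = ys
  (x ∷ xs) +ᵖ []       = x ∷ xs
  (x ∷ xs) +ᵖ (y ∷ ys) = (x + y) ∷ (xs +ᵖ ys)

  _*ᵖ_ : Poly → Poly → Poly
  []       *ᵖ ys = []
  (x ∷ xs) *ᵖ ys = map (x *_) ys +ᵖ (0# ∷ (xs *ᵖ ys))

  X-_ : Carrier → Poly
  X- x = (- x) ∷ 1# ∷ []

  productᵖ : List Poly → Poly
  productᵖ = foldr _*ᵖ_ (1# ∷ [])

  -- The n-th cyclotomic polynomial when ζ is a primitive n-th root of unity.
  Φ : ℕ → Carrier → Poly
  Φ n ζ = productᵖ (map (λ k → X- (ζ P.^ k)) (totatives n))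

  -- f = Σₙ a(n) xⁿ with integers a(n), zero beyond the degree of f.  The
  -- sequence a is determined by f, as fromℤ is injective in characteristic zero.
  HasIntegerCoefficients : Poly → (ℕ → ℤ) → Set ℓ₁
  HasIntegerCoefficients f a = ∀ n → coeff f n ≈ fromℤ (a n)

{-# OPTIONS --safe #-}

-- Clearing denominators in the product over the totatives gives
--   Φ (1 - x)(1 - x^pq)(1 - x^qr)(1 - x^rp) = (1 - x^pqr)(1 - x^p)(1 - x^q)(1 - x^r),
-- so for n < pqr the coefficient a(n) is the sum, over the window n - p < m ≤ n, of
--   S(m) = e(m) - e(m-q) - e(m-r) + e(m-q-r),
-- where e(m) = 1 if m = x qr + y rp + z pq with x, y, z ≥ 0, and e(m) = 0 otherwise.
--
-- Every integer m is uniquely x qr + y rp + z pq - l pqr with 0 ≤ x < p, 0 ≤ y < q,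
-- 0 ≤ z < r, and e(m) = 1 iff the level l is 0.  Subtracting q or r from m moves the
-- coordinates cyclically and changes l by the number of wrap-arounds, so S(m) ∈ {-1, 0, 1}
-- is determined by l and by how x, y, z compare with fixed thresholds; in particular the
-- sign of S(m) depends only on x.  Along the window x runs once through all residues
-- modulo p, and counting residues yields the bounds p - β and β.  Outside an x-interval of
-- length α, S(m) ≠ 0 moreover fixes l and confines y and z to short intervals; as m varies
-- by less than p, this confines x to a short interval too, which yields 2α + β and
-- p + 2α - β.

module Submission where

open import Defs
open import Algebra.Apartness.Bundles using (HeytingField; HeytingCommutativeRing)
open import Algebra.Bundles using (AbelianGroup; CommutativeRing)
open import Data.Empty using (⊥; ⊥-elim)
open import Data.Fin using (Fin; zero; suc; fromℕ<; toℕ)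
open import Data.Fin.Patterns using (0F; 1F; 2F)
open import Data.Fin.Properties using (all?; fromℕ<-injective; injective⇒≤)
open import Data.Integer as ℤ using (ℤ; +_; -[1+_])
open import Data.Integer.DivMod using (_%ℕ_; _/ℕ_; a≡a%ℕn+[a/ℕn]*n; n%ℕd<d)
import Data.Integer.Divisibility.Signed as Signed
import Data.Integer.Properties as ℤₚ
open import Data.Integer.Tactic.RingSolver using (solve-∀)
open import Data.List using (List; []; _∷_; _++_; applyUpTo; filter; foldr; length; map; replicate; upTo)
open import Data.List.Membership.Propositional using (_∈_)
open import Data.List.Membership.Propositional.Properties using (∈-filter⁺; ∈-filter⁻; ∈-map⁺; ∈-map⁻; ∈-upTo⁺; ∈-upTo⁻)
open import Data.List.Membership.Propositional.Properties.WithK using (unique∧set⇒bag)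
import Data.List.Properties as Listₚ
open import Data.List.Relation.Binary.BagAndSetEquality using (∼bag⇒↭)
open import Data.List.Relation.Binary.Permutation.Propositional as ↭ using (_↭_; ↭-refl; ↭-reflexive; ↭-sym; ↭-trans)
import Data.List.Relation.Binary.Permutation.Propositional.Properties as ↭ₚ
open import Data.List.Relation.Unary.All using (All; []; _∷_)
open import Data.List.Relation.Unary.Any using (here)
import Data.List.Relation.Unary.Unique.Propositional.Properties as Uniqueₚ
open import Data.Nat as ℕ using (ℕ; zero; suc; NonZero)
open import Data.Nat.Coprimality using (Coprime; coprime-Bézout; coprime-divisor; coprime⇒gcd≡1; gcd≡1⇒coprime; 1-coprimeTo) renaming (sym to coprime-sym)
open import Data.Nat.DivMod using (_%_; _/_; m%n<n; m≡m%n+[m/n]*n)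
open import Data.Nat.Divisibility using (_∣_; _∤_; _∣?_; _∣0; divides; >⇒∤; ∣-refl; ∣-trans; ∣m⇒∣m*n; m∣m*n; n∣m*n; m*n∣⇒m∣; m*n∣⇒n∣)
open import Data.Nat.GCD using (gcd; module Bézout)
open import Data.Nat.Primality using (Prime; prime⇒irreducible; prime⇒nonTrivial; prime⇒nonZero)
import Data.Nat.Properties as ℕₚ
open import Data.Product using (_×_; _,_; proj₁; proj₂; ∃-syntax)
open import Data.Sum using (_⊎_; inj₁; inj₂; [_,_])
open import Data.Unit using (⊤; tt)
open import Function using (_∘_; _⇔_; mk⇔; Equivalence)
open import Relation.Binary.Definitions using (tri<; tri≈; tri>)
open import Relation.Binary.PropositionalEquality as ≡ using (_≡_; _≢_)
open import Relation.Nullary using (¬_; Dec; does; yes; no; contradiction; _×-dec_; _⊎-dec_; _→-dec_; ¬?)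
open import Relation.Nullary.Decidable using (does-⇔; from-yes)
open import Relation.Unary using (Decidable; Pred)

-- Two-sided sequences and multiplication by X^k - a

-- The thresholds come from r = q′ qr + b rp - pqr and q = r′ qr + c pq - pqr: subtracting r moves x
-- by q′ and y by b, subtracting q moves x by r′ and z by c. Since αβqr ≡ 1 modulo p, α = q′ forces
-- β = r′, and α = p - q′ forces β = p - r′; exchanging q and r covers the other two values of α.
-- Minimality of α orders the thresholds q′, r′, q′ + r′ (modulo p) along [0, p) in such a way that
-- S ≥ 0 on p - β residues x and S ≤ 0 on the other β.
--
-- The bounds 2α + β and p + 2α - β rest on qr(x - x′) = (m - m′) + rp(y′ - y) + pq(z′ - z) for two
-- points of equal level. The intervals for y and z have lengths about q h / p and r h′ / p, where h
-- is q′ or p - q′ and h′ is r′ or p - r′, so x varies by less than h + h′.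
--
-- No quotient of polynomials is formed: both sides stay multiplied out, and factors X^k - 1 are
-- cancelled by a recurrence. The window sum is compared with Φ only below pqr, which suffices
-- because Φ has degree less than pqr.

module Identities {c ℓ} (R : CommutativeRing c ℓ) where

  open CommutativeRing R
  open import Algebra.Solver.Ring.NaturalCoefficients.Default commutativeSemiring

  factor-comm-identity : ∀ w x y z a b → (w + b * x) + a * (y + b * z) ≈ (w + a * y) + b * (x + a * z)
  factor-comm-identity = solve 6 (λ w x y z a b →
    ((w :+ b :* x) :+ a :* (y :+ b :* z)) := ((w :+ a :* y) :+ b :* (x :+ a :* z))) refl

  dilate-suc : ∀ ζ z a x y → (ζ * z) * (x + (ζ * a) * y) ≈ ζ * (z * x + a * ((ζ * z) * y))
  dilate-suc = solve 5 (λ ζ z a x y →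
    ((ζ :* z) :* (x :+ (ζ :* a) :* y)) := (ζ :* (z :* x :+ a :* ((ζ :* z) :* y)))) refl

  dilate-cons : ∀ ζ z c x y → ζ * (z * x + c * (z * y)) ≈ (ζ * z) * (x + c * y)
  dilate-cons = solve 5 (λ ζ z c x y →
    (ζ :* (z :* x :+ c :* (z :* y))) := ((ζ :* z) :* (x :+ c :* y))) refl

module Sequences {c ℓ} (R : CommutativeRing c ℓ) where

  open CommutativeRing R
  open import Algebra.Properties.Group +-group using (x∙y⁻¹≈ε⇒x≈y)
  open import Algebra.Properties.Ring ring using (-1*x≈-x; -‿distribʳ-*; -‿+-comm; -‿involutive)
  open import Relation.Binary.Reasoning.Setoid setoid

  open Identities R

  -- Indexing by all of ℤ makes a shift a plain subtraction, without truncation at 0; being a power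
  -- series is the separate condition `Causal`.
  Seq : Set c
  Seq = ℤ → Carrier

  infix 4 _≋_ _≋_below_

  _≋_ : Seq → Seq → Set ℓ
  f ≋ g = ∀ n → f n ≈ g n

  _≋_below_ : Seq → Seq → ℕ → Set ℓ
  f ≋ g below b = ∀ n → n ℤ.< + b → f n ≈ g n

  Causal : Seq → Set ℓ
  Causal f = ∀ n → f -[1+ n ] ≈ 0#

  δ : Seq
  δ (+ zero)  = 1#
  δ (+ suc _) = 0#
  δ -[1+ _ ]  = 0#

  [X^_+_] : ℕ → Carrier → Seq → Seq
  [X^ k + a ] f n = f (n ℤ.- + k) + a * f n

  -- The sign is the one in which the product of all X - ζᵏ comes out. The identity for Φ has four
  -- such factors on either side, so it is unaffected.
  [X^_-1] : ℕ → Seq → Seq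
  [X^ k -1] = [X^ k + - 1# ]

  factor-1 : ∀ k f n → [X^ k -1] f n ≈ f (n ℤ.- + k) - f n
  factor-1 k f n = +-congˡ (-1*x≈-x (f n))

  factor-cong : ∀ k {a b f g} → a ≈ b → f ≋ g → [X^ k + a ] f ≋ [X^ k + b ] g
  factor-cong k a≈b f≋g n = +-cong (f≋g _) (*-cong a≈b (f≋g n))

  factor-cong-below : ∀ k a b f g → f ≋ g below b → [X^ k + a ] f ≋ [X^ k + a ] g below b
  factor-cong-below k a b f g f≋g n n<b = +-cong
    (f≋g _ (ℤₚ.≤-<-trans (ℤₚ.i-j≤i n (+ k)) n<b))
    (*-congˡ (f≋g n n<b))

  private
    swap-shift : ∀ n k l → n ℤ.- k ℤ.- l ≡ n ℤ.- l ℤ.- k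
    swap-shift = solve-∀

  factor-comm : ∀ k l a b f → [X^ k + a ] ([X^ l + b ] f) ≋ [X^ l + b ] ([X^ k + a ] f)
  factor-comm k l a b f n = begin
    (f (n ℤ.- + k ℤ.- + l) + b * f (n ℤ.- + k)) + a * (f (n ℤ.- + l) + b * f n)
      ≡⟨ ≡.cong (λ m → (f m + b * f (n ℤ.- + k)) + a * (f (n ℤ.- + l) + b * f n)) (swap-shift n (+ k) (+ l)) ⟩
    (f (n ℤ.- + l ℤ.- + k) + b * f (n ℤ.- + k)) + a * (f (n ℤ.- + l) + b * f n)
      ≈⟨ factor-comm-identity _ _ _ _ a b ⟩
    (f (n ℤ.- + l ℤ.- + k) + a * f (n ℤ.- + l)) + b * (f (n ℤ.- + k) + a * f n) ∎

  x+a0≈x : ∀ {x y z} a → x ≈ z → y ≈ 0# → x + a * y ≈ z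
  x+a0≈x {x} {y} {z} a x≈z y≈0 = begin
    x + a * y   ≈⟨ +-cong x≈z (trans (*-congˡ y≈0) (zeroʳ a)) ⟩
    z + 0#      ≈⟨ +-identityʳ z ⟩
    z           ∎

  private
    neg-shift : ∀ n k → -[1+ n ] ℤ.- + k ≡ -[1+ n ℕ.+ k ]
    neg-shift n zero    = ≡.cong -[1+_] (≡.sym (ℕₚ.+-identityʳ n))
    neg-shift n (suc k) = ≡.cong -[1+_] (≡.sym (ℕₚ.+-suc n k))

  factor-causal : ∀ k a f → Causal f → Causal ([X^ k + a ] f)
  factor-causal k a f f0 n =
    x+a0≈x a (trans (reflexive (≡.cong f (neg-shift n k))) (f0 _)) (f0 n)

  δ-causal : Causal δ
  δ-causal n = refl

  private
    x-y≈x′-y′ : ∀ {x y x′ y′} → x - y ≈ x′ - y′ → x ≈ x′ → y ≈ y′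
    x-y≈x′-y′ {x} {y} {x′} {y′} eq x≈x′ = begin
      y               ≈⟨ lem x y ⟩
      x - (x - y)     ≈⟨ +-cong x≈x′ (-‿cong eq) ⟩
      x′ - (x′ - y′)  ≈⟨ lem x′ y′ ⟨
      y′              ∎
      where
      lem : ∀ x y → y ≈ x - (x - y)
      lem x y = sym (begin
        x - (x - y)        ≈⟨ +-congˡ (-‿+-comm x (- y)) ⟨
        x + (- x + - - y)  ≈⟨ +-assoc _ _ _ ⟨
        (x - x) + - - y    ≈⟨ +-cong (-‿inverseʳ x) (-‿involutive y) ⟩
        0# + y             ≈⟨ +-identityˡ y ⟩
        y                  ∎)

  -- The product determines f(n) from f(n - k - 1), so equality propagates upwards from the negative
  -- indices, where both sequences vanish. Computing f(n) uses no index above n, which is why a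
  -- cut-off at b does no harm.
  factor-cancel : ∀ k b {f g} → Causal f → Causal g →
    [X^ suc k -1] f ≋ [X^ suc k -1] g below b → f ≋ g below b
  factor-cancel k b {f} {g} f0 g0 eq n n<b = go (suc ℤ.∣ n ∣) n (bound n) n<b
    where
    bound : ∀ n → n ℤ.< + suc ℤ.∣ n ∣
    bound (+ n)    = ℤ.+<+ (ℕₚ.n<1+n n)
    bound -[1+ n ] = ℤ.-<+
    step : ∀ m n → + n ℤ.< + suc m → + n ℤ.- + suc k ℤ.< + m
    step m n (ℤ.+<+ n<1+m) = ℤₚ.<-≤-trans
      (ℤₚ.<-≤-trans (ℤₚ.+-monoʳ-< (+ n) ℤ.-<+) (ℤₚ.≤-reflexive (ℤₚ.+-identityʳ (+ n))))
      (ℤ.+≤+ (ℕₚ.≤-pred n<1+m))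
    go : ∀ m n → n ℤ.< + m → n ℤ.< + b → f n ≈ g n
    go _       -[1+ n ] _   _   = trans (f0 n) (sym (g0 n))
    go zero    (+ n)    (ℤ.+<+ ()) _
    go (suc m) (+ n)    n<m n<b = x-y≈x′-y′
      (trans (sym (factor-1 (suc k) f (+ n))) (trans (eq (+ n) n<b) (factor-1 (suc k) g (+ n))))
      (go m (+ n ℤ.- + suc k) (step m n n<m) (ℤₚ.<-trans (step n n (ℤ.+<+ (ℕₚ.n<1+n n))) n<b))

  factors : List ℕ → Seq → Seq
  factors ks f = foldr [X^_-1] f ks

  factors-causal : ∀ ks f → Causal f → Causal (factors ks f)
  factors-causal []       f f0 = f0
  factors-causal (k ∷ ks) f f0 = factor-causal k (- 1#) (factors ks f) (factors-causal ks f f0)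

  factors-cancel : ∀ ks b f g → All (0 ℕ.<_) ks → Causal f → Causal g →
    factors ks f ≋ factors ks g below b → f ≋ g below b
  factors-cancel []           b f g []        f0 g0 eq = eq
  factors-cancel (suc k ∷ ks) b f g (_ ∷ ks>0) f0 g0 eq = factors-cancel ks b f g ks>0 f0 g0
    (factor-cancel k b (factors-causal ks f f0) (factors-causal ks g g0) eq)

  factors-cong-below : ∀ ks b f g → f ≋ g below b → factors ks f ≋ factors ks g below b
  factors-cong-below []       b f g f≋g = f≋g
  factors-cong-below (k ∷ ks) b f g f≋g =
    factor-cong-below k (- 1#) b (factors ks f) (factors ks g) (factors-cong-below ks b f g f≋g)

  factors-↭ : ∀ {ks ls} f → ks ↭ ls → factors ks f ≋ factors ls f
  factors-↭ f ↭.refl n          = refl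
  factors-↭ f (↭.prep k p)      = factor-cong k refl (factors-↭ f p)
  factors-↭ f (↭.swap {xs} k l p) n =
    trans (factor-comm k l (- 1#) (- 1#) (factors xs f) n) (factor-cong l refl (factor-cong k refl (factors-↭ f p)) n)
  factors-↭ f (↭.trans p q) n   = trans (factors-↭ f p n) (factors-↭ f q n)

  X-root : Carrier → Seq → Seq
  X-root c = [X^ 1 + - c ]

  roots : List Carrier → Seq → Seq
  roots cs f = foldr X-root f cs

  roots-cong : ∀ cs {f g} → f ≋ g → roots cs f ≋ roots cs g
  roots-cong []       f≋g = f≋g
  roots-cong (c ∷ cs) f≋g = factor-cong 1 refl (roots-cong cs f≋g)

  roots-factor : ∀ cs k a f → roots cs ([X^ k + a ] f) ≋ [X^ k + a ] (roots cs f)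
  roots-factor []       k a f n = refl
  roots-factor (c ∷ cs) k a f n =
    trans (factor-cong 1 refl (roots-factor cs k a f) n) (factor-comm 1 k (- c) a (roots cs f) n)

  roots-↭ : ∀ {cs ds} f → cs ↭ ds → roots cs f ≋ roots ds f
  roots-↭ f ↭.refl n          = refl
  roots-↭ f (↭.prep c p)      = factor-cong 1 refl (roots-↭ f p)
  roots-↭ f (↭.swap {xs} c d p) n =
    trans (factor-comm 1 1 (- c) (- d) (roots xs f) n) (factor-cong 1 refl (factor-cong 1 refl (roots-↭ f p)) n)
  roots-↭ f (↭.trans p q) n   = trans (roots-↭ f p n) (roots-↭ f q n)

  roots-causal : ∀ cs → Causal (roots cs δ)
  roots-causal []       = δ-causal
  roots-causal (c ∷ cs) = factor-causal 1 (- c) (roots cs δ) (roots-causal cs)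

  roots-degree : ∀ cs n → length cs ℕ.< n → roots cs δ (+ n) ≈ 0#
  roots-degree []       (suc n) _           = refl
  roots-degree (c ∷ cs) (suc n) (ℕ.s≤s len<n) =
    x+a0≈x (- c) (roots-degree cs n len<n) (roots-degree cs (suc n) (ℕₚ.m≤n⇒m≤1+n len<n))

  roots-leading : ∀ cs → roots cs δ (+ length cs) ≈ 1#
  roots-leading []       = refl
  roots-leading (c ∷ cs) = x+a0≈x (- c) (roots-leading cs) (roots-degree cs _ (ℕₚ.n<1+n _))

  open import Algebra.Properties.Semiring.Exp semiring using (_^_)

  -- The substitution X ↦ ζX.  Negative indices get 0 instead of a power of ζ⁻¹, which
  -- does not matter for causal sequences.
  dilate : Carrier → Seq → Seq
  dilate ζ f (+ n)    = ζ ^ n * f (+ n)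
  dilate ζ f -[1+ n ] = 0#

  private
    dilate-zero : ∀ {x y} ζ a → x ≈ 0# → 1# * (x + (ζ * a) * y) ≈ ζ * (0# + a * (1# * y))
    dilate-zero {x} {y} ζ a x≈0 = begin
      1# * (x + (ζ * a) * y)          ≈⟨ *-identityˡ _ ⟩
      x + (ζ * a) * y                 ≈⟨ +-cong (trans x≈0 (sym (zeroʳ ζ))) (*-assoc ζ a y) ⟩
      ζ * 0# + ζ * (a * y)            ≈⟨ distribˡ ζ 0# (a * y) ⟨
      ζ * (0# + a * y)                ≈⟨ *-congˡ (+-congˡ (*-congˡ (*-identityˡ y))) ⟨
      ζ * (0# + a * (1# * y))         ∎

  -- Under X ↦ ζX the factor X + ζa becomes ζ(X + a). Causality matters at index 0, where `dilate`
  -- has erased the entry of f at -1.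
  dilate-factor : ∀ ζ a f → Causal f →
    ∀ n → dilate ζ ([X^ 1 + ζ * a ] f) n ≈ ζ * [X^ 1 + a ] (dilate ζ f) n
  dilate-factor ζ a f f0 (+ zero)  = dilate-zero ζ a (f0 0)
  dilate-factor ζ a f f0 (+ suc n) = dilate-suc ζ (ζ ^ n) a (f (+ n)) (f (+ suc n))
  dilate-factor ζ a f f0 -[1+ n ]  = sym (trans (*-congˡ (x+a0≈x a refl refl)) (zeroʳ ζ))

  dilate-roots : ∀ ζ cs n →
    dilate ζ (roots (map (ζ *_) cs) δ) n ≈ ζ ^ length cs * roots cs δ n
  dilate-roots ζ [] (+ zero)   = refl
  dilate-roots ζ [] (+ suc n)  = trans (zeroʳ _) (sym (zeroʳ _))
  dilate-roots ζ [] -[1+ n ]   = sym (zeroʳ _)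
  dilate-roots ζ (c ∷ cs) n = begin
    dilate ζ ([X^ 1 + - (ζ * c) ] (roots (map (ζ *_) cs) δ)) n
      ≈⟨ dilate-cong n (factor-cong 1 (-‿distribʳ-* ζ c) (λ _ → refl)) ⟩
    dilate ζ ([X^ 1 + ζ * - c ] (roots (map (ζ *_) cs) δ)) n
      ≈⟨ dilate-factor ζ (- c) _ (roots-causal (map (ζ *_) cs)) n ⟩
    ζ * [X^ 1 + - c ] (dilate ζ (roots (map (ζ *_) cs) δ)) n
      ≈⟨ *-congˡ (factor-cong 1 refl (dilate-roots ζ cs) n) ⟩
    ζ * (ζᵏ * roots cs δ (n ℤ.- + 1) + - c * (ζᵏ * roots cs δ n))
      ≈⟨ dilate-cons ζ ζᵏ (- c) _ _ ⟩
    (ζ * ζᵏ) * [X^ 1 + - c ] (roots cs δ) n ∎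
    where
    ζᵏ = ζ ^ length cs
    dilate-cong : ∀ {f g} n → f ≋ g → dilate ζ f n ≈ dilate ζ g n
    dilate-cong (+ n)    f≋g = *-congˡ (f≋g (+ n))
    dilate-cong -[1+ n ] f≋g = refl

  -- The product P of all X - ζᵏ is invariant under X ↦ ζX, so its coefficients
  -- strictly between 0 and N vanish; those of P / (X - 1) are then all equal.
  module Unity (ζ : Carrier) (N : ℕ) (ζᴺ≈1 : ζ ^ suc N ≈ 1#)
    (regular : ∀ n x → 0 ℕ.< n → n ℕ.< suc N → ζ ^ n * x ≈ x → x ≈ 0#) where

    private
      qs : List Carrier
      qs = applyUpTo (λ k → ζ ^ suc k) N

      P Q : Seq
      P = roots (applyUpTo (ζ ^_) (suc N)) δ
      Q = roots qs δ

      length-qs : length qs ≡ N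
      length-qs = Listₚ.length-applyUpTo _ N

      -- Multiplication by ζ moves the list of powers on by one, and its new last entry, the power
      -- of exponent `suc N`, is 1, the entry lost at the front.
      rotate : roots (map (ζ *_) (applyUpTo (ζ ^_) (suc N))) δ ≋ P
      rotate n = begin
        roots (map (ζ *_) (applyUpTo (ζ ^_) (suc N))) δ n
          ≡⟨ ≡.cong (λ cs → roots cs δ n) (≡.trans (Listₚ.map-applyUpTo (ζ ^_) (ζ *_) (suc N)) (≡.sym (Listₚ.applyUpTo-∷ʳ (λ k → ζ ^ suc k) N))) ⟩
        roots (qs ++ ζ ^ suc N ∷ []) δ n
          ≡⟨ ≡.cong (λ f → f n) (Listₚ.foldr-++ X-root δ qs (ζ ^ suc N ∷ [])) ⟩
        roots qs (X-root (ζ ^ suc N) δ) n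
          ≈⟨ roots-factor qs 1 (- (ζ ^ suc N)) δ n ⟩
        X-root (ζ ^ suc N) Q n
          ≈⟨ factor-cong 1 {f = Q} (-‿cong ζᴺ≈1) (λ _ → refl) n ⟩
        P n ∎

      invariant : ∀ n → ζ ^ n * P (+ n) ≈ P (+ n)
      invariant n = begin
        ζ ^ n * P (+ n)  ≈⟨ *-congˡ (rotate (+ n)) ⟨
        dilate ζ (roots (map (ζ *_) (applyUpTo (ζ ^_) (suc N))) δ) (+ n)
          ≈⟨ dilate-roots ζ (applyUpTo (ζ ^_) (suc N)) (+ n) ⟩
        ζ ^ length (applyUpTo (ζ ^_) (suc N)) * P (+ n)
          ≡⟨ ≡.cong (λ k → ζ ^ k * P (+ n)) (Listₚ.length-applyUpTo (ζ ^_) (suc N)) ⟩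
        ζ ^ suc N * P (+ n)  ≈⟨ *-congʳ ζᴺ≈1 ⟩
        1# * P (+ n)         ≈⟨ *-identityˡ _ ⟩
        P (+ n)              ∎

      middle : ∀ n → n ℕ.< N → P (+ suc n) ≈ 0#
      middle n n<N = regular (suc n) _ ℕ.z<s (ℕ.s<s n<N) (invariant (suc n))

      Q-step : ∀ n → n ℕ.< N → Q (+ n) ≈ Q (+ suc n)
      Q-step n n<N = x∙y⁻¹≈ε⇒x≈y _ _ (trans (sym (factor-1 1 Q (+ suc n))) (middle n n<N))

      -- Induction runs downwards from the leading coefficient; d is the distance to it.
      Q≈1 : ∀ d n → d ℕ.+ n ≡ N → Q (+ n) ≈ 1#
      Q≈1 zero    n ≡.refl =
        trans (reflexive (≡.cong (λ k → Q (+ k)) (≡.sym length-qs))) (roots-leading qs)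
      Q≈1 (suc d) n ≡.refl =
        trans (Q-step n (ℕₚ.m<n+m n ℕ.z<s)) (Q≈1 d (suc n) (ℕₚ.+-suc d n))

      shifted-δ : ∀ k → [X^ suc N -1] δ (+ suc k) ≈ δ (suc k ℤ.⊖ suc N)
      shifted-δ k = x+a0≈x (- 1#) refl refl

    unity : P ≋ [X^ suc N -1] δ
    unity -[1+ n ] = trans (roots-causal (applyUpTo (ζ ^_) (suc N)) n)
                           (sym (factor-causal (suc N) (- 1#) δ δ-causal n))
    -- The constant term of P is -Q(0), and Q(0) equals the leading coefficient of Q.
    unity (+ zero) = +-cong (roots-causal qs 0) (*-congˡ (Q≈1 N 0 (ℕₚ.+-identityʳ N)))
    unity (+ suc n) with ℕₚ.<-cmp n N
    ... | tri< n<N _ _ = trans (middle n n<N) (sym (trans (shifted-δ n) (reflexive (≡.cong δ (neg n<N)))))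
      where
      neg : ∀ {n N} → n ℕ.< N → suc n ℤ.⊖ suc N ≡ -[1+ N ℕ.∸ suc n ]
      neg {n} {suc N} (ℕ.s≤s n≤N) = ≡.trans (ℤₚ.⊖-< (ℕ.s<s (ℕ.s≤s n≤N))) (≡.cong (λ k → ℤ.- + k) (ℕₚ.+-∸-assoc 1 n≤N))
    ... | tri≈ _ ≡.refl _ = trans
      (≡.subst (λ k → P (+ k) ≈ 1#) (Listₚ.length-applyUpTo (ζ ^_) (suc N)) (roots-leading (applyUpTo (ζ ^_) (suc N))))
      (sym (trans (shifted-δ n) (reflexive (≡.cong δ (ℤₚ.n⊖n≡0 (suc n))))))
    ... | tri> _ _ N<n = trans
      (roots-degree (applyUpTo (ζ ^_) (suc N)) (suc n) (≡.subst (ℕ._< suc n) (≡.sym (Listₚ.length-applyUpTo (ζ ^_) (suc N))) (ℕ.s<s N<n)))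
      (sym (trans (shifted-δ n) (reflexive (≡.cong δ (pos N<n)))))
      where
      pos : ∀ {n N} → N ℕ.< n → suc n ℤ.⊖ suc N ≡ + suc (n ℕ.∸ suc N)
      pos {suc n} {N} (ℕ.s≤s N≤n) = ≡.trans (ℤₚ.⊖-≥ (ℕₚ.m≤n⇒m≤1+n (ℕ.s≤s N≤n))) (≡.cong +_ (ℕₚ.+-∸-assoc 1 N≤n))

-- Inclusion–exclusion for the totatives of pqr

module Totatives where

  open import Data.Bool using (true; false; if_then_else_)
  open import Data.Nat using (_+_; _*_; _<_)
  open ≡ using (refl; sym; trans; cong; cong₂; subst)

  prime∤⇒coprime : ∀ {p k} → Prime p → p ∤ k → Coprime k p
  prime∤⇒coprime p-prime p∤k (d∣k , d∣p) with prime⇒irreducible p-prime d∣p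
  ... | inj₁ d≡1  = d≡1
  ... | inj₂ refl = contradiction d∣k p∤k

  prime≢1 : ∀ {p} → Prime p → p ≢ 1
  prime≢1 p-prime = ℕ.nonTrivial⇒≢1 {{prime⇒nonTrivial p-prime}}

  distinct-primes-coprime : ∀ {p q} → Prime p → Prime q → p ≢ q → Coprime p q
  distinct-primes-coprime {p} {q} p-prime q-prime p≢q =
    prime∤⇒coprime q-prime λ q∣p →
      [ prime≢1 q-prime , p≢q ∘ sym ] (prime⇒irreducible p-prime q∣p)

  coprime-*-∣ : ∀ {m n k} → Coprime m n → m ∣ k → n ∣ k → m * n ∣ k
  coprime-*-∣ {m} {n} c (divides j refl) n∣jm =
    subst (_∣ j * m) (ℕₚ.*-comm n m) (divide (coprime-divisor (coprime-sym c) (subst (n ∣_) (ℕₚ.*-comm j m) n∣jm)))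
    where
    divide : n ∣ j → n * m ∣ j * m
    divide (divides i refl) = divides i (ℕₚ.*-assoc i n m)

  indicator : ∀ {a} {A : Set a} → Dec A → ℕ
  indicator a? = if does a? then 1 else 0

  -- Sublists of a fixed list become multiplicity functions, so a permutation between concatenations
  -- of sublists reduces to an identity of natural numbers at each entry.
  withMultiplicity : (ℕ → ℕ) → List ℕ → List ℕ
  withMultiplicity w []       = []
  withMultiplicity w (k ∷ ks) = replicate (w k) k ++ withMultiplicity w ks

  withMultiplicity-cong : ∀ {v w} → (∀ k → v k ≡ w k) → ∀ ks → withMultiplicity v ks ≡ withMultiplicity w ks
  withMultiplicity-cong v≡w []       = refl
  withMultiplicity-cong v≡w (k ∷ ks) =
    cong₂ (λ n → replicate n k ++_) (v≡w k) (withMultiplicity-cong v≡w ks)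

  withMultiplicity-+ : ∀ v w ks →
    withMultiplicity v ks ++ withMultiplicity w ks ↭ withMultiplicity (λ k → v k + w k) ks
  withMultiplicity-+ v w []       = ↭-refl
  withMultiplicity-+ v w (k ∷ ks) = begin
    (a ++ A) ++ (b ++ B)  ≡⟨ Listₚ.++-assoc a A (b ++ B) ⟩
    a ++ A ++ b ++ B      ↭⟨ ↭ₚ.++⁺ˡ a (↭ₚ.shifts A b) ⟩
    a ++ b ++ A ++ B      ≡⟨ Listₚ.++-assoc a b (A ++ B) ⟨
    (a ++ b) ++ A ++ B    ↭⟨ ↭ₚ.++⁺ (↭-reflexive (replicate-+ (v k))) (withMultiplicity-+ v w ks) ⟩
    withMultiplicity (λ k → v k + w k) (k ∷ ks) ∎
    where
    open ↭.PermutationReasoning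
    a = replicate (v k) k
    b = replicate (w k) k
    A = withMultiplicity v ks
    B = withMultiplicity w ks
    replicate-+ : ∀ m {n} → replicate m k ++ replicate n k ≡ replicate (m + n) k
    replicate-+ zero    = refl
    replicate-+ (suc m) = cong (k ∷_) (replicate-+ m)

  filter≡withMultiplicity : ∀ {ℓ} {P : Pred ℕ ℓ} (P? : Decidable P) ks →
    filter P? ks ≡ withMultiplicity (indicator ∘ P?) ks
  filter≡withMultiplicity P? []       = refl
  filter≡withMultiplicity P? (k ∷ ks) with does (P? k)
  ... | true  = cong (k ∷_) (filter≡withMultiplicity P? ks)
  ... | false = filter≡withMultiplicity P? ks

  withMultiplicity-1 : ∀ ks → ks ≡ withMultiplicity (λ _ → 1) ks
  withMultiplicity-1 []       = refl
  withMultiplicity-1 (k ∷ ks) = cong (k ∷_) (withMultiplicity-1 ks)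

  module _ {ℓ} {P Q R : Pred ℕ ℓ} (P? : Decidable P) (Q? : Decidable Q) (R? : Decidable R) where

    private
      filter-+ : ∀ {ℓ} {S : Pred ℕ ℓ} (S? : Decidable S) w {ls} ks → ls ↭ withMultiplicity w ks →
        filter S? ks ++ ls ↭ withMultiplicity (λ k → indicator (S? k) + w k) ks
      filter-+ S? w ks ls↭ = ↭-trans
        (↭ₚ.++⁺ (↭-reflexive (filter≡withMultiplicity S? ks)) ls↭)
        (withMultiplicity-+ (indicator ∘ S?) w ks)

    -- Terms with a minus sign are moved across, since lists cannot be subtracted. If j of the three
    -- conditions hold at k, the multiplicities agree because C(j,2) + 1 = j + C(j,3) + [j = 0] for
    -- j ≤ 3.
    inclusion-exclusion : ∀ {t} {T : Pred ℕ t} (T? : Decidable T) →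
      (∀ k → T k ⇔ (¬ (P k ⊎ Q k ⊎ R k))) → ∀ ks →
      filter (λ k → P? k ×-dec Q? k) ks ++ filter (λ k → P? k ×-dec R? k) ks ++ filter (λ k → Q? k ×-dec R? k) ks ++ ks
      ↭ filter P? ks ++ filter Q? ks ++ filter R? ks ++ filter (λ k → P? k ×-dec Q? k ×-dec R? k) ks ++ filter T? ks
    inclusion-exclusion T? T⇔ ks = ↭-trans
      (filter-+ (λ k → P? k ×-dec Q? k) _ ks
        (filter-+ (λ k → P? k ×-dec R? k) _ ks
          (filter-+ (λ k → Q? k ×-dec R? k) _ ks (↭-reflexive (withMultiplicity-1 ks)))))
      (↭-trans (↭-reflexive (withMultiplicity-cong weights ks))
      (↭-sym
        (filter-+ P? _ ks (filter-+ Q? _ ks (filter-+ R? _ ks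
          (filter-+ (λ k → P? k ×-dec Q? k ×-dec R? k) _ ks (↭-reflexive (filter≡withMultiplicity T? ks))))))))
      where
      weights : ∀ k →
        indicator (P? k ×-dec Q? k) + (indicator (P? k ×-dec R? k) + (indicator (Q? k ×-dec R? k) + 1)) ≡
        indicator (P? k) + (indicator (Q? k) + (indicator (R? k) + (indicator (P? k ×-dec Q? k ×-dec R? k) + indicator (T? k))))
      weights k rewrite does-⇔ (T⇔ k) (T? k) (¬? (P? k ⊎-dec Q? k ⊎-dec R? k))
        with does (P? k) | does (Q? k) | does (R? k)
      ... | true  | true  | true  = refl
      ... | true  | true  | false = refl
      ... | true  | false | true  = refl
      ... | true  | false | false = refl
      ... | false | true  | true  = refl
      ... | false | true  | false = refl
      ... | false | false | true  = refl
      ... | false | false | false = refl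

  -- Both lists are free of duplicates, so having the same members already makes them permutations
  -- of each other.
  multiples : ∀ {ℓ} {D : Pred ℕ ℓ} (D? : Decidable D) d m .{{_ : NonZero d}} → (∀ k → D k ⇔ d ∣ k) →
    filter D? (upTo (d * m)) ↭ map (d *_) (upTo m)
  multiples {D = D} D? d m D⇔ = ∼bag⇒↭ (unique∧set⇒bag
    (Uniqueₚ.filter⁺ D? (Uniqueₚ.upTo⁺ (d * m)))
    (Uniqueₚ.map⁺ (ℕₚ.*-cancelˡ-≡ _ _ d) (Uniqueₚ.upTo⁺ m))
    (mk⇔ to from))
    where
    to : ∀ {k} → k ∈ filter D? (upTo (d * m)) → k ∈ map (d *_) (upTo m)
    to {k} k∈ with ∈-filter⁻ D? {xs = upTo (d * m)} k∈
    ... | k∈upTo , Dk with Equivalence.to (D⇔ k) Dk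
    ... | divides j refl = subst (_∈ map (d *_) (upTo m)) (ℕₚ.*-comm d j)
          (∈-map⁺ (d *_) (∈-upTo⁺ (ℕₚ.*-cancelˡ-< d j m (subst (_< d * m) (ℕₚ.*-comm j d) (∈-upTo⁻ k∈upTo)))))
    from : ∀ {k} → k ∈ map (d *_) (upTo m) → k ∈ filter D? (upTo (d * m))
    from k∈ with ∈-map⁻ (d *_) k∈
    ... | j , j∈ , refl = ∈-filter⁺ D? (∈-upTo⁺ (ℕₚ.*-monoʳ-< d (∈-upTo⁻ j∈))) (Equivalence.from (D⇔ (d * j)) (m∣m*n j))

  module _ {p q r : ℕ} (p-prime : Prime p) (q-prime : Prime q) (r-prime : Prime r)
    (p≢q : p ≢ q) (p≢r : p ≢ r) (q≢r : q ≢ r) where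

    private
      instance
        p≢0 : NonZero p
        p≢0 = prime⇒nonZero p-prime
        q≢0 : NonZero q
        q≢0 = prime⇒nonZero q-prime
        r≢0 : NonZero r
        r≢0 = prime⇒nonZero r-prime

      c-pq = distinct-primes-coprime p-prime q-prime p≢q
      c-pr = distinct-primes-coprime p-prime r-prime p≢r
      c-qr = distinct-primes-coprime q-prime r-prime q≢r

      N = p * q * r

      pair : ∀ {m n} → Coprime m n → ∀ k → (m ∣ k × n ∣ k) ⇔ m * n ∣ k
      pair {m} {n} c k = mk⇔ (λ (m∣k , n∣k) → coprime-*-∣ c m∣k n∣k) (λ mn∣k → m*n∣⇒m∣ m n mn∣k , m*n∣⇒n∣ m n mn∣k)

      coprime-pq-r : Coprime (p * q) r
      coprime-pq-r = prime∤⇒coprime r-prime λ r∣pq →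
        prime≢1 r-prime (c-qr (coprime-divisor (coprime-sym c-pr) r∣pq , ∣-refl))

      triple : ∀ k → (p ∣ k × q ∣ k × r ∣ k) ⇔ N ∣ k
      triple k = mk⇔
        (λ (p∣k , q∣k , r∣k) → coprime-*-∣ coprime-pq-r (coprime-*-∣ c-pq p∣k q∣k) r∣k)
        (λ N∣k → m*n∣⇒m∣ p q (m*n∣⇒m∣ (p * q) r N∣k) , m*n∣⇒n∣ p q (m*n∣⇒m∣ (p * q) r N∣k) , m*n∣⇒n∣ (p * q) r N∣k)

      coprime⇔ : ∀ k → (0 < k × gcd k N ≡ 1) ⇔ (¬ (p ∣ k ⊎ q ∣ k ⊎ r ∣ k))
      coprime⇔ k = mk⇔ to from
        where
        to : 0 < k × gcd k N ≡ 1 → ¬ (p ∣ k ⊎ q ∣ k ⊎ r ∣ k)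
        to (_ , gcd≡1) (inj₁ p∣k) = prime≢1 p-prime (gcd≡1⇒coprime gcd≡1 (p∣k , ∣m⇒∣m*n r (m∣m*n q)))
        to (_ , gcd≡1) (inj₂ (inj₁ q∣k)) = prime≢1 q-prime (gcd≡1⇒coprime gcd≡1 (q∣k , ∣m⇒∣m*n r (n∣m*n p)))
        to (_ , gcd≡1) (inj₂ (inj₂ r∣k)) = prime≢1 r-prime (gcd≡1⇒coprime gcd≡1 (r∣k , n∣m*n (p * q)))
        positive : ∀ k → p ∤ k → 0 < k
        positive zero    p∤0 = contradiction (p ∣0) p∤0
        positive (suc k) _   = ℕ.z<s
        from : ¬ (p ∣ k ⊎ q ∣ k ⊎ r ∣ k) → 0 < k × gcd k N ≡ 1
        from none = positive k (none ∘ inj₁) , coprime⇒gcd≡1 coprime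
          where
          drop : ∀ {s d n} → Prime s → s ∤ k → d ∣ k → d ∣ s * n → d ∣ n
          drop s-prime s∤k d∣k = coprime-divisor λ (e∣d , e∣s) → prime∤⇒coprime s-prime s∤k (∣-trans e∣d d∣k , e∣s)
          coprime : Coprime k N
          coprime {d} (d∣k , d∣N) = prime∤⇒coprime q-prime (none ∘ inj₂ ∘ inj₁) (d∣k ,
            drop p-prime (none ∘ inj₁) d∣k (drop r-prime (none ∘ inj₂ ∘ inj₂) d∣k (subst (d ∣_) (ℕₚ.*-comm (p * q) r) d∣N)))

      multiplesOf : ∀ {ℓ} {D : Pred ℕ ℓ} (D? : Decidable D) d m .{{_ : NonZero d}} → (∀ k → D k ⇔ d ∣ k) → d * m ≡ N →
        filter D? (upTo N) ↭ map (d *_) (upTo m)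
      multiplesOf D? d m D⇔ eq = subst (λ n → filter D? (upTo n) ↭ map (d *_) (upTo m)) eq (multiples D? d m D⇔)

      ∣⇔ : ∀ d k → (d ∣ k) ⇔ (d ∣ k)
      ∣⇔ d k = mk⇔ (λ z → z) (λ z → z)

      instance
        pq≢0 = ℕₚ.m*n≢0 p q
        pr≢0 = ℕₚ.m*n≢0 p r
        qr≢0 = ℕₚ.m*n≢0 q r
        N≢0  = ℕₚ.m*n≢0 (p * q) r

    -- The entries serve as exponents of ζ. A block `map (d *_) (upTo m)` with d m = N lists the
    -- m-th roots of unity and so stands for X^m - 1; the block of `N` holds only the exponent 0.
    totatives-inclusion-exclusion :
      map (p * q *_) (upTo r) ++ map (p * r *_) (upTo q) ++ map (q * r *_) (upTo p) ++ upTo N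
      ↭ map (p *_) (upTo (q * r)) ++ map (q *_) (upTo (p * r)) ++ map (r *_) (upTo (p * q)) ++ map (N *_) (upTo 1) ++ totatives N
    totatives-inclusion-exclusion = ↭-trans
      (↭ₚ.++⁺ (↭-sym (multiplesOf _ (p * q) r (pair c-pq) refl))
      (↭ₚ.++⁺ (↭-sym (multiplesOf _ (p * r) q (pair c-pr) prq))
      (↭ₚ.++⁺ (↭-sym (multiplesOf _ (q * r) p (pair c-qr) qrp)) ↭-refl)))
      (↭-trans
      (inclusion-exclusion (p ∣?_) (q ∣?_) (r ∣?_) _ coprime⇔ (upTo N))
      (↭ₚ.++⁺ (multiplesOf _ p (q * r) (∣⇔ p) (sym (ℕₚ.*-assoc p q r)))
      (↭ₚ.++⁺ (multiplesOf _ q (p * r) (∣⇔ q) qpr)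
      (↭ₚ.++⁺ (multiplesOf _ r (p * q) (∣⇔ r) (ℕₚ.*-comm r (p * q)))
      (↭ₚ.++⁺ (multiplesOf _ N 1 triple (ℕₚ.*-identityʳ N)) ↭-refl)))))
      where
      prq : p * r * q ≡ N
      prq = trans (ℕₚ.*-assoc p r q) (trans (cong (p *_) (ℕₚ.*-comm r q)) (sym (ℕₚ.*-assoc p q r)))
      qrp : q * r * p ≡ N
      qrp = trans (ℕₚ.*-comm (q * r) p) (sym (ℕₚ.*-assoc p q r))
      qpr : q * (p * r) ≡ N
      qpr = trans (sym (ℕₚ.*-assoc q p r)) (cong (_* r) (ℕₚ.*-comm q p))

-- The coefficients of Φ over a field of characteristic zero

open Totatives

open Sequences ℤₚ.+-*-commutativeRing using ()
  renaming (δ to δℤ; [X^_-1] to [X^_-1]ℤ; factors to factorsℤ; Causal to Causalℤ; _≋_below_ to _≋ℤ_below_; factor-1 to factor-1ℤ)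

module Field {c ℓ₁ ℓ₂} (K : HeytingField c ℓ₁ ℓ₂) (char0 : CharacteristicZero K) where

  open HeytingField K using (#⇒invertible; #-irrefl; heytingCommutativeRing)

  R : CommutativeRing c ℓ₁
  R = HeytingCommutativeRing.commutativeRing heytingCommutativeRing

  open CommutativeRing R
  open Sequences R
  open import Algebra.Properties.Ring ring using (-0#≈0#; [y-z]x≈yx-zx; -‿+-comm; -‿involutive)
  open import Algebra.Properties.Semiring.Exp semiring using (_^_; ^-assocʳ; ^-congʳ)
  open import Algebra.Properties.Monoid.Mult +-monoid using (×-homo-+) renaming (_×_ to _·_)
  open import Relation.Binary.Reasoning.Setoid setoid

  private
    fromK = fromℤ K

  fromℤ-⊖ : ∀ m n → fromK (m ℤ.⊖ n) ≈ m · 1# - n · 1#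
  fromℤ-⊖ m       zero    = sym (trans (+-congˡ -0#≈0#) (+-identityʳ _))
  fromℤ-⊖ zero    (suc n) = sym (+-identityˡ _)
  fromℤ-⊖ (suc m) (suc n) = begin
    fromK (suc m ℤ.⊖ suc n)              ≡⟨ ≡.cong fromK (ℤₚ.[1+m]⊖[1+n]≡m⊖n m n) ⟩
    fromK (m ℤ.⊖ n)                      ≈⟨ fromℤ-⊖ m n ⟩
    m · 1# - n · 1#                      ≈⟨ +-congʳ (+-identityˡ _) ⟨
    (0# + m · 1#) - n · 1#               ≈⟨ +-congʳ (+-congʳ (-‿inverseʳ 1#)) ⟨
    ((1# - 1#) + m · 1#) - n · 1#        ≈⟨ solve 4 (λ a b c d → ((a :+ b) :+ c) :+ d := (a :+ c) :+ (b :+ d)) refl _ _ _ _ ⟩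
    (1# + m · 1#) + (- 1# - n · 1#)      ≈⟨ +-congˡ (-‿+-comm _ _) ⟩
    (1# + m · 1#) - (1# + n · 1#)        ∎
    where open import Algebra.Solver.Ring.NaturalCoefficients.Default commutativeSemiring

  fromℤ-+ : ∀ i j → fromK (i ℤ.+ j) ≈ fromK i + fromK j
  fromℤ-+ (+ m)    (+ n)    = ×-homo-+ 1# m n
  fromℤ-+ (+ m)    -[1+ n ] = fromℤ-⊖ m (suc n)
  fromℤ-+ -[1+ m ] (+ n)    = trans (fromℤ-⊖ n (suc m)) (+-comm _ _)
  fromℤ-+ -[1+ m ] -[1+ n ] = begin
    - (suc (suc (m ℕ.+ n)) · 1#)      ≡⟨ ≡.cong (λ k → - (suc k · 1#)) (ℕₚ.+-suc m n) ⟨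
    - ((suc m ℕ.+ suc n) · 1#)        ≈⟨ -‿cong (×-homo-+ 1# (suc m) (suc n)) ⟩
    - (suc m · 1# + suc n · 1#)       ≈⟨ -‿+-comm _ _ ⟨
    - (suc m · 1#) - suc n · 1#       ∎

  fromℤ-neg : ∀ i → fromK (ℤ.- i) ≈ - fromK i
  fromℤ-neg (+ zero)  = sym -0#≈0#
  fromℤ-neg (+ suc n) = refl
  fromℤ-neg -[1+ n ]  = sym (-‿involutive _)

  fromℤ-- : ∀ i j → fromK (i ℤ.- j) ≈ fromK i - fromK j
  fromℤ-- i j = trans (fromℤ-+ i (ℤ.- j)) (+-congˡ (fromℤ-neg j))

  fromℤ≈0⇒≡0 : ∀ i → fromK i ≈ 0# → i ≡ + 0
  fromℤ≈0⇒≡0 (+ zero)  _  = ≡.refl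
  fromℤ≈0⇒≡0 (+ suc n) eq = contradiction (char0 n) (#-irrefl eq)
  fromℤ≈0⇒≡0 -[1+ n ]  eq = contradiction (char0 n)
    (#-irrefl (trans (sym (-‿involutive _)) (trans (-‿cong eq) -0#≈0#)))

  fromℤ-injective : ∀ i j → fromK i ≈ fromK j → i ≡ j
  fromℤ-injective i j eq = ℤₚ.i-j≡0⇒i≡j i j (fromℤ≈0⇒≡0 (i ℤ.- j)
    (trans (fromℤ-- i j) (trans (+-congʳ eq) (-‿inverseʳ _))))

  factor-fromℤ : ∀ k f → [X^ k -1] (fromK ∘ f) ≋ fromK ∘ [X^ k -1]ℤ f
  factor-fromℤ k f n = begin
    [X^ k -1] (fromK ∘ f) n                     ≈⟨ factor-1 k (fromK ∘ f) n ⟩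
    fromK (f (n ℤ.- + k)) - fromK (f n)         ≈⟨ fromℤ-- (f (n ℤ.- + k)) (f n) ⟨
    fromK (f (n ℤ.- + k) ℤ.- f n)               ≡⟨ ≡.cong fromK (factor-1ℤ k f n) ⟨
    fromK ([X^ k -1]ℤ f n)                      ∎

  factors-fromℤ : ∀ ks f g → f ≋ fromK ∘ g → factors ks f ≋ fromK ∘ factorsℤ ks g
  factors-fromℤ []       f g f≋g   = f≋g
  factors-fromℤ (k ∷ ks) f g f≋g n = trans (factor-cong k refl (factors-fromℤ ks f g f≋g) n) (factor-fromℤ k (factorsℤ ks g) n)

  δ-fromℤ : δ ≋ fromK ∘ δℤ
  δ-fromℤ (+ zero)  = sym (+-identityʳ 1#)
  δ-fromℤ (+ suc n) = refl
  δ-fromℤ -[1+ n ]  = refl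

  private
    _*P_ = _*ᵖ_ K
    _+P_ = _+ᵖ_ K

  coeff-+ᵖ : ∀ xs ys n → coeff K (xs +P ys) n ≈ coeff K xs n + coeff K ys n
  coeff-+ᵖ []       ys       n       = sym (+-identityˡ _)
  coeff-+ᵖ (x ∷ xs) []       n       = sym (+-identityʳ _)
  coeff-+ᵖ (x ∷ xs) (y ∷ ys) zero    = refl
  coeff-+ᵖ (x ∷ xs) (y ∷ ys) (suc n) = coeff-+ᵖ xs ys n

  coeff-map : ∀ x ys n → coeff K (map (x *_) ys) n ≈ x * coeff K ys n
  coeff-map x []       n       = sym (zeroʳ x)
  coeff-map x (y ∷ ys) zero    = refl
  coeff-map x (y ∷ ys) (suc n) = coeff-map x ys n

  coefficients : Poly K → Seq
  coefficients f (+ n)    = coeff K f n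
  coefficients f -[1+ n ] = 0#

  coefficients-*ᵖ : ∀ c f → coefficients (X-_ K c *P f) ≋ X-root c (coefficients f)
  coefficients-*ᵖ c f -[1+ n ]  = sym (factor-causal 1 (- c) (coefficients f) (λ _ → refl) n)
  coefficients-*ᵖ c f (+ zero)  = trans (coeff-+ᵖ (map (- c *_) f) _ 0)
    (trans (+-cong (coeff-map (- c) f 0) refl) (+-comm _ _))
  coefficients-*ᵖ c f (+ suc n) = begin
    coeff K (X-_ K c *P f) (suc n)
      ≈⟨ coeff-+ᵖ (map (- c *_) f) _ (suc n) ⟩
    coeff K (map (- c *_) f) (suc n) + coeff K (map (1# *_) f +P (0# ∷ [])) n
      ≈⟨ +-cong (coeff-map (- c) f (suc n)) (coeff-+ᵖ (map (1# *_) f) (0# ∷ []) n) ⟩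
    - c * coeff K f (suc n) + (coeff K (map (1# *_) f) n + coeff K (0# ∷ []) n)
      ≈⟨ +-congˡ (+-cong (trans (coeff-map 1# f n) (*-identityˡ _)) (coeff-zero n)) ⟩
    - c * coeff K f (suc n) + (coeff K f n + 0#)
      ≈⟨ trans (+-congˡ (+-identityʳ _)) (+-comm _ _) ⟩
    coeff K f n + - c * coeff K f (suc n) ∎
    where
    coeff-zero : ∀ n → coeff K (0# ∷ []) n ≈ 0#
    coeff-zero zero    = refl
    coeff-zero (suc n) = refl

  module _ (ζ : Carrier) where

    rootsAt : List ℕ → Seq → Seq
    rootsAt ks = roots (map (ζ ^_) ks)

    coefficients-Φ : ∀ n → coefficients (Φ K n ζ) ≋ rootsAt (totatives n) δ
    coefficients-Φ n = go (totatives n)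
      where
      go : ∀ ks → coefficients (productᵖ K (map (λ k → X-_ K (ζ ^ k)) ks)) ≋ rootsAt ks δ
      go [] (+ zero)   = refl
      go [] (+ suc n)  = refl
      go [] -[1+ n ]   = refl
      go (k ∷ ks) n = trans (coefficients-*ᵖ (ζ ^ k) _ n) (factor-cong 1 refl (go ks) n)

    module _ (N : ℕ) (isPrimitive : IsPrimitiveRoot K N ζ) where

      open IsPrimitiveRoot isPrimitive

      -- Apartness of ζᵏ and 1 supplies an inverse of ζᵏ - 1; this is the only division in K.
      ζᵏx≈x⇒x≈0 : ∀ k x → 0 ℕ.< k → k ℕ.< N → ζ ^ k * x ≈ x → x ≈ 0#
      ζᵏx≈x⇒x≈0 k x 0<k k<N eq with #⇒invertible (ζᵏ#1 k 0<k k<N)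
      ... | inv , inv*≈1 , _ = begin
        x                             ≈⟨ *-identityˡ x ⟨
        1# * x                        ≈⟨ *-congʳ inv*≈1 ⟨
        (inv * (ζ ^ k - 1#)) * x      ≈⟨ *-assoc _ _ _ ⟩
        inv * ((ζ ^ k - 1#) * x)      ≈⟨ *-congˡ ([y-z]x≈yx-zx x (ζ ^ k) 1#) ⟩
        inv * (ζ ^ k * x - 1# * x)    ≈⟨ *-congˡ (+-cong eq (-‿cong (*-identityˡ x))) ⟩
        inv * (x - x)                 ≈⟨ *-congˡ (-‿inverseʳ x) ⟩
        inv * 0#                      ≈⟨ zeroʳ inv ⟩
        0#                            ∎

      roots-multiples : ∀ d m → 0 ℕ.< d → 0 ℕ.< m → d ℕ.* m ≡ N →
        rootsAt (map (d ℕ.*_) (upTo m)) δ ≋ [X^ m -1] δ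
      roots-multiples d (suc m) 0<d _ dm≡N n = begin
        rootsAt (map (d ℕ.*_) (upTo (suc m))) δ n
          ≡⟨ ≡.cong (λ cs → roots cs δ n) (≡.trans (≡.sym (Listₚ.map-∘ (upTo (suc m)))) (Listₚ.map-upTo (λ j → ζ ^ (d ℕ.* j)) (suc m))) ⟩
        roots (applyUpTo (λ j → ζ ^ (d ℕ.* j)) (suc m)) δ n
          ≈⟨ roots-applyUpTo (suc m) (λ j → sym (^-assocʳ ζ d j)) n ⟩
        roots (applyUpTo (η ^_) (suc m)) δ n
          ≈⟨ Unity.unity η m ηᵐ≈1 regular n ⟩
        [X^ suc m -1] δ n ∎
        where
        η = ζ ^ d
        roots-applyUpTo : ∀ m {g h} → (∀ j → g j ≈ h j) → roots (applyUpTo g m) δ ≋ roots (applyUpTo h m) δ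
        roots-applyUpTo zero    g≈h n = refl
        roots-applyUpTo (suc m) g≈h   = factor-cong 1 (-‿cong (g≈h 0)) (roots-applyUpTo m (g≈h ∘ suc))
        ηᵐ≈1 : η ^ suc m ≈ 1#
        ηᵐ≈1 = trans (^-assocʳ ζ d (suc m)) (trans (^-congʳ ζ dm≡N) ζⁿ≈1)
        regular : ∀ k x → 0 ℕ.< k → k ℕ.< suc m → η ^ k * x ≈ x → x ≈ 0#
        regular k x 0<k k<m eq = ζᵏx≈x⇒x≈0 (d ℕ.* k) x
          (ℕₚ.*-mono-< 0<d 0<k)
          (≡.subst (d ℕ.* k ℕ.<_) dm≡N (ℕₚ.*-monoʳ-< d {{ℕ.>-nonZero 0<d}} k<m))
          (trans (*-congʳ (sym (^-assocʳ ζ d k))) eq)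

      -- A block of roots is evaluated only on δ. It is therefore permuted to the innermost
      -- position, replaced by X^m - 1 there, and this factor is pulled out again.
      roots-multiples-++ : ∀ d m ks f → 0 ℕ.< d → 0 ℕ.< m → d ℕ.* m ≡ N → rootsAt ks δ ≋ f →
        rootsAt (map (d ℕ.*_) (upTo m) ++ ks) δ ≋ [X^ m -1] f
      roots-multiples-++ d m ks f 0<d 0<m dm≡N eq n = begin
        rootsAt (ds ++ ks) δ n               ≈⟨ roots-↭ δ (↭ₚ.map⁺ (ζ ^_) (↭ₚ.++-comm ds ks)) n ⟩
        rootsAt (ks ++ ds) δ n               ≡⟨ ≡.cong (λ cs → roots cs δ n) (Listₚ.map-++ (ζ ^_) ks ds) ⟩
        roots (map (ζ ^_) ks ++ map (ζ ^_) ds) δ n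
                                             ≡⟨ ≡.cong (λ g → g n) (Listₚ.foldr-++ X-root δ (map (ζ ^_) ks) (map (ζ ^_) ds)) ⟩
        rootsAt ks (rootsAt ds δ) n          ≈⟨ roots-cong (map (ζ ^_) ks) (roots-multiples d m 0<d 0<m dm≡N) n ⟩
        rootsAt ks ([X^ m -1] δ) n           ≈⟨ roots-factor (map (ζ ^_) ks) m (- 1#) δ n ⟩
        [X^ m -1] (rootsAt ks δ) n           ≈⟨ factor-cong m refl eq n ⟩
        [X^ m -1] f n                        ∎
        where ds = map (d ℕ.*_) (upTo m)

  module _ {p q r : ℕ} (p-prime : Prime p) (q-prime : Prime q) (r-prime : Prime r)
    (p≢q : p ≢ q) (p≢r : p ≢ r) (q≢r : q ≢ r)
    (ζ : Carrier) (isPrimitive : IsPrimitiveRoot K (p ℕ.* q ℕ.* r) ζ)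
    (a : ℕ → ℤ) (a-coefficients : HasIntegerCoefficients K (Φ K (p ℕ.* q ℕ.* r) ζ) a) where

    private
      N = p ℕ.* q ℕ.* r

      0<p : 0 ℕ.< p
      0<p = ℕ.>-nonZero⁻¹ p {{prime⇒nonZero p-prime}}
      0<q : 0 ℕ.< q
      0<q = ℕ.>-nonZero⁻¹ q {{prime⇒nonZero q-prime}}
      0<r : 0 ℕ.< r
      0<r = ℕ.>-nonZero⁻¹ r {{prime⇒nonZero r-prime}}
      0<pq = ℕₚ.*-mono-< 0<p 0<q
      0<pr = ℕₚ.*-mono-< 0<p 0<r
      0<qr = ℕₚ.*-mono-< 0<q 0<r
      0<N  = ℕₚ.*-mono-< 0<pq 0<r

      φ : Seq
      φ = coefficients (Φ K N ζ)

      numerator denominator : List ℕ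
      numerator   = r ∷ q ∷ p ∷ N ∷ []
      denominator = q ℕ.* r ∷ p ℕ.* r ∷ p ℕ.* q ∷ 1 ∷ []

    Φ-identity : factors denominator φ ≋ factors numerator δ
    Φ-identity n = begin
      factors denominator φ n
        ≈⟨ expand p (q ℕ.* r) _ _ 0<p 0<qr (≡.sym (ℕₚ.*-assoc p q r))
          (expand q (p ℕ.* r) _ _ 0<q 0<pr (≡.trans (≡.sym (ℕₚ.*-assoc q p r)) (≡.cong (ℕ._* r) (ℕₚ.*-comm q p)))
          (expand r (p ℕ.* q) _ _ 0<r 0<pq (ℕₚ.*-comm r (p ℕ.* q))
          (expand N 1 (totatives N) φ 0<N ℕ.z<s (ℕₚ.*-identityʳ N)
          (λ n → sym (coefficients-Φ ζ N n))))) n ⟨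
      rootsAt ζ (map (p ℕ.*_) (upTo (q ℕ.* r)) ++ map (q ℕ.*_) (upTo (p ℕ.* r)) ++ map (r ℕ.*_) (upTo (p ℕ.* q)) ++ map (N ℕ.*_) (upTo 1) ++ totatives N) δ n
        ≈⟨ roots-↭ δ (↭ₚ.map⁺ (ζ ^_) (totatives-inclusion-exclusion p-prime q-prime r-prime p≢q p≢r q≢r)) n ⟨
      rootsAt ζ (map (p ℕ.* q ℕ.*_) (upTo r) ++ map (p ℕ.* r ℕ.*_) (upTo q) ++ map (q ℕ.* r ℕ.*_) (upTo p) ++ upTo N) δ n
        ≈⟨ expand (p ℕ.* q) r _ _ 0<pq 0<r ≡.refl
          (expand (p ℕ.* r) q _ _ 0<pr 0<q (≡.trans (ℕₚ.*-assoc p r q) (≡.trans (≡.cong (p ℕ.*_) (ℕₚ.*-comm r q)) (≡.sym (ℕₚ.*-assoc p q r))))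
          (expand (q ℕ.* r) p (upTo N) ([X^ N -1] δ) 0<qr 0<p (≡.trans (ℕₚ.*-comm (q ℕ.* r) p) (≡.sym (ℕₚ.*-assoc p q r)))
          all-roots)) n ⟩
      factors numerator δ n ∎
      where
      expand : ∀ d m ks f → 0 ℕ.< d → 0 ℕ.< m → d ℕ.* m ≡ N → rootsAt ζ ks δ ≋ f →
        rootsAt ζ (map (d ℕ.*_) (upTo m) ++ ks) δ ≋ [X^ m -1] f
      expand = roots-multiples-++ ζ N isPrimitive
      all-roots : rootsAt ζ (upTo N) δ ≋ [X^ N -1] δ
      all-roots n = trans
        (reflexive (≡.cong (λ ks → rootsAt ζ ks δ n) (≡.sym (≡.trans (Listₚ.map-cong ℕₚ.*-identityˡ (upTo N)) (Listₚ.map-id (upTo N))))))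
        (roots-multiples ζ N isPrimitive 1 N ℕ.z<s 0<N (ℕₚ.*-identityˡ N) n)

    -- Φ has fewer than N linear factors, because 0 is below N and is not a totative.
    coefficients-beyond : ∀ n → N ℕ.≤ n → a n ≡ + 0
    coefficients-beyond n N≤n = fromℤ≈0⇒≡0 (a n) (begin
      fromK (a n)                              ≈⟨ a-coefficients n ⟨
      φ (+ n)                                  ≈⟨ coefficients-Φ ζ N (+ n) ⟩
      rootsAt ζ (totatives N) δ (+ n)          ≈⟨ roots-degree (map (ζ ^_) (totatives N)) n len<n ⟩
      0#                                       ∎)
      where
      shorter : ∀ {N} → 0 ℕ.< N → length (totatives N) ℕ.< N
      shorter {suc N} _ = ≡.subst (length (totatives (suc N)) ℕ.<_) (Listₚ.length-upTo (suc N))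
        (Listₚ.filter-notAll (λ k → (0 ℕₚ.<? k) ×-dec (gcd k (suc N) ℕₚ.≟ 1)) (upTo (suc N)) (here λ ()))
      len<n : length (map (ζ ^_) (totatives N)) ℕ.< n
      len<n = ≡.subst (ℕ._< n) (≡.sym (Listₚ.length-map (ζ ^_) (totatives N))) (ℕₚ.<-≤-trans (shorter 0<N) N≤n)

    -- This identifies an integer sequence with the coefficients without computing in K: its image
    -- satisfies the same cleared equation as Φ below N, the factors cancel there, and `fromK` is
    -- injective.
    coefficients-determined : ∀ A → Causalℤ A →
      factorsℤ (q ℕ.* r ∷ p ℕ.* r ∷ p ℕ.* q ∷ 1 ∷ []) A ≋ℤ factorsℤ (r ∷ q ∷ p ∷ N ∷ []) δℤ below N →
      ∀ n → n ℕ.< N → a n ≡ A (+ n)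
    coefficients-determined A A-causal eq n n<N = fromℤ-injective (a n) (A (+ n))
      (trans (sym (a-coefficients n)) (agree (+ n) (ℤ.+<+ n<N)))
      where
      ψ : Seq
      ψ = fromK ∘ A

      agree : φ ≋ ψ below N
      agree = factors-cancel denominator N φ ψ (0<qr ∷ 0<pr ∷ 0<pq ∷ ℕ.z<s ∷ [])
        (λ _ → refl) (λ n → reflexive (≡.cong fromK (A-causal n)))
        λ n n<N → begin
          factors denominator φ n                 ≈⟨ Φ-identity n ⟩
          factors numerator δ n                   ≈⟨ factors-fromℤ numerator δ δℤ δ-fromℤ n ⟩
          fromK (factorsℤ numerator δℤ n)         ≡⟨ ≡.cong fromK (eq n n<N) ⟨
          fromK (factorsℤ denominator A n)        ≈⟨ factors-fromℤ denominator ψ A (λ _ → refl) n ⟨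
          factors denominator ψ n                 ∎

open Sequences ℤₚ.+-*-commutativeRing
open import Data.Integer using (_+_; _*_; _-_; -_; _≤_; _<_; ∣_∣)
open ≡ using (refl; sym; trans; cong; cong₂; subst; subst₂; module ≡-Reasoning)
open import Algebra.Properties.Group (AbelianGroup.group ℤₚ.+-0-abelianGroup) using () renaming (∙-cancelˡ to +-cancelˡ)

-- Coordinates of an integer with respect to qr, rp, pq

0≤+ : ∀ {i j} → + 0 ≤ i → + 0 ≤ j → + 0 ≤ i + j
0≤+ = ℤₚ.+-mono-≤

0≤* : ∀ {i j} → + 0 ≤ i → + 0 ≤ j → + 0 ≤ i * j
0≤* {+ m} {+ n} _ _ = subst (+ 0 ≤_) (ℤₚ.pos-* m n) (ℤ.+≤+ ℕ.z≤n)

≤⇒0≤ : ∀ {i j} → i ≤ j → + 0 ≤ j - i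
≤⇒0≤ = ℤₚ.i≤j⇒0≤j-i

-- Inequalities are proved by exhibiting their slack as a visibly nonnegative expression.
≤-slack : ∀ {i j} d → j - i ≡ d → + 0 ≤ d → i ≤ j
≤-slack d eq 0≤d = ℤₚ.0≤i-j⇒j≤i (subst (+ 0 ≤_) (sym eq) 0≤d)

<⇒0≤ : ∀ {i j} → i < j → + 0 ≤ j - i - + 1
<⇒0≤ {i} {j} i<j = subst (+ 0 ≤_) (lem i j) (≤⇒0≤ (ℤₚ.i<j⇒suc[i]≤j i<j))
  where
  lem : ∀ i j → j - (+ 1 + i) ≡ j - i - + 1
  lem = solve-∀

<-slack : ∀ {i j} d → j - i - + 1 ≡ d → + 0 ≤ d → i < j
<-slack {i} {j} d eq 0≤d = ℤₚ.suc[i]≤j⇒i<j (≤-slack d (trans (lem i j) eq) 0≤d)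
  where
  lem : ∀ i j → j - (+ 1 + i) ≡ j - i - + 1
  lem = solve-∀

record InRange (x : ℤ) (p : ℕ) : Set where
  constructor range
  field
    nonneg  : + 0 ≤ x
    bounded : x < + p

-- As s is coprime to p, p divides x - y, whose absolute value is less than p.
inRange-unique : ∀ {p s x y} k → Coprime p s → InRange x p → InRange y p →
  (x - y) * + s ≡ k * + p → x ≡ y
inRange-unique {p} {s} {+ x} {+ y} k c (range _ (ℤ.+<+ x<p)) (range _ (ℤ.+<+ y<p)) eq =
  ℤₚ.i-j≡0⇒i≡j (+ x) (+ y) (ℤₚ.∣i∣≡0⇒i≡0 (small ∣d∣<p
    (coprime-divisor c (divides ∣ k ∣ (trans (ℕₚ.*-comm s _) (trans (sym (ℤₚ.abs-* (+ x - + y) (+ s)))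
      (trans (cong ∣_∣ eq) (ℤₚ.abs-* k (+ p)))))))))
  where
  small : ∀ {m} → m ℕ.< p → p ∣ m → m ≡ 0
  small {zero}  _   _   = refl
  small {suc m} m<p p∣m = contradiction p∣m (>⇒∤ m<p)
  ∣d∣<p : ∣ + x - + y ∣ ℕ.< p
  ∣d∣<p = subst (λ d → ∣ d ∣ ℕ.< p) (sym (ℤₚ.m-n≡m⊖n x y))
    (ℕₚ.≤-<-trans (ℤₚ.∣m⊝n∣≤m⊔n x y) (ℕₚ.⊔-pres-<m x<p y<p))

bézout : ∀ {m n} → Coprime m n → ∃[ u ] ∃[ v ] u * + m + v * + n ≡ + 1
bézout {m} {n} c with coprime-Bézout c
... | Bézout.+- x y eq = + x , - + y , trans
  (cong₂ _+_ (trans (sym (ℤₚ.pos-* x m)) (cong +_ (sym eq))) (trans (sym (ℤₚ.neg-distribˡ-* (+ y) (+ n))) (cong -_ (sym (ℤₚ.pos-* y n)))))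
  (lem (+ (y ℕ.* n)))
  where
  lem : ∀ i → (+ 1 + i) - i ≡ + 1
  lem = solve-∀
... | Bézout.-+ x y eq = - + x , + y , trans
  (cong₂ _+_ (trans (sym (ℤₚ.neg-distribˡ-* (+ x) (+ m))) (cong -_ (sym (ℤₚ.pos-* x m)))) (trans (sym (ℤₚ.pos-* y n)) (cong +_ (sym eq))))
  (lem (+ (x ℕ.* m)))
  where
  lem : ∀ i → - i + (+ 1 + i) ≡ + 1
  lem = solve-∀

δ-nonzero : ∀ {i} → i ≢ + 0 → δ i ≡ + 0
δ-nonzero {+ zero}  i≢0 = contradiction refl i≢0
δ-nonzero {+ suc _} _   = refl
δ-nonzero { -[1+ _ ] } _ = refl

δ-positive : ∀ {i} → + 0 < i → δ i ≡ + 0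
δ-positive 0<i = δ-nonzero (λ i≡0 → ℤₚ.<-irrefl (sym i≡0) 0<i)

-- Multiplication by 1 + X + ... + X^(k-1).
box : ℕ → Seq → Seq
box zero    f n = + 0
box (suc k) f n = box k f n + f (n - + k)

box-factor : ∀ k f → [X^ 1 -1] (box k f) ≋ [X^ k -1] f
box-factor k f n = trans (factor-1 1 (box k f) n) (trans (telescope k) (sym (factor-1 k f n)))
  where
  telescope : ∀ k → box k f (n - + 1) - box k f n ≡ f (n - + k) - f n
  telescope zero    = sym (trans (cong (λ m → f m - f n) (ℤₚ.+-identityʳ n)) (ℤₚ.+-inverseʳ (f n)))
  telescope (suc k) = begin
    (box k f (n - + 1) + f (n - + 1 - + k)) - (box k f n + f (n - + k))
      ≡⟨ rearrange (box k f (n - + 1)) (f (n - + 1 - + k)) (box k f n) (f (n - + k)) ⟩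
    (box k f (n - + 1) - box k f n) + (f (n - + 1 - + k) - f (n - + k))
      ≡⟨ cong₂ _+_ (telescope k) (cong (λ m → f m - f (n - + k)) (merge n (+ k))) ⟩
    (f (n - + k) - f n) + (f (n - + suc k) - f (n - + k))
      ≡⟨ collapse (f (n - + k)) (f n) (f (n - + suc k)) ⟩
    f (n - + suc k) - f n ∎
    where
    open ≡-Reasoning
    rearrange : ∀ a b c d → (a + b) - (c + d) ≡ (a - c) + (b - d)
    rearrange = solve-∀
    merge : ∀ n k → n - + 1 - k ≡ n - (+ 1 + k)
    merge = solve-∀
    collapse : ∀ a b c → (a - b) + (c - a) ≡ c - b
    collapse = solve-∀

box-causal : ∀ k f → Causal f → Causal (box k f)
box-causal zero    f f0 n = refl
box-causal (suc k) f f0 n = cong₂ _+_ (box-causal k f f0 n) (shifted k)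
  where
  shifted : ∀ k → f (-[1+ n ] - + k) ≡ + 0
  shifted zero    = f0 n
  shifted (suc k) = f0 (suc (n ℕ.+ k))

-- A device for using equations with the ring solver: the solver rewrites a goal so that two known
-- equations appear as differences of their sides, which are then dropped here.
difference : ∀ {i j a b} → i ≡ a → j ≡ b → ∀ {c} → (i - a) - (j - b) + c ≡ c
difference {i} {j} refl refl {c} = lem i j c
  where
  lem : ∀ i j c → (i - i) - (j - j) + c ≡ c
  lem = solve-∀

module Lattice (p q r : ℕ) .{{_ : NonZero p}} .{{_ : NonZero q}} .{{_ : NonZero r}}
  (pq : Coprime p q) (pr : Coprime p r) (qr : Coprime q r) where

  P Q R N : ℤ
  P = + p
  Q = + q
  R = + r
  N = P * Q * R

  N≡ : N ≡ + (p ℕ.* q ℕ.* r)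
  N≡ = sym (trans (ℤₚ.pos-* (p ℕ.* q) r) (cong (_* R) (ℤₚ.pos-* p q)))

  record Rep (m x y z l : ℤ) : Set where
    constructor rep
    field
      x-range : InRange x p
      y-range : InRange y q
      z-range : InRange z r
      equation : x * (Q * R) + y * (R * P) + z * (P * Q) ≡ m + l * N

  private
    coprime-* : ∀ {a b c} → Coprime a b → Coprime a c → Coprime a (b ℕ.* c)
    coprime-* ab ac {d} (d∣a , d∣bc) =
      ac (d∣a , coprime-divisor (λ (e∣d , e∣b) → ab (∣-trans e∣d d∣a , e∣b)) d∣bc)

  -- Modulo p the equation reads x qr ≡ m, and qr is invertible. The other two coordinates are read
  -- off modulo q and r in the same way.
  x-unique : ∀ {m x y z l m′ x′ y′ z′ l′} k → Rep m x y z l → Rep m′ x′ y′ z′ l′ →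
    m - m′ ≡ k * P → x ≡ x′
  x-unique {m} {x} {y} {z} {l} {m′} {x′} {y′} {z′} {l′} k (rep xr _ _ e) (rep xr′ _ _ e′) m≡ =
    inRange-unique (k + ((y′ - y) * R + (z′ - z) * Q + (l - l′) * (Q * R))) (coprime-* pq pr) xr xr′
    (begin
      (x - x′) * + (q ℕ.* r)  ≡⟨ cong ((x - x′) *_) (ℤₚ.pos-* q r) ⟩
      (x - x′) * (Q * R)      ≡⟨ lem P Q R x y z l m x′ y′ z′ l′ m′ ⟩
      _                       ≡⟨ difference e e′ ⟩
      (m - m′) + ((y′ - y) * R + (z′ - z) * Q + (l - l′) * (Q * R)) * P ≡⟨ cong (_+ _) m≡ ⟩
      k * P + ((y′ - y) * R + (z′ - z) * Q + (l - l′) * (Q * R)) * P ≡⟨ ℤₚ.*-distribʳ-+ P k _ ⟨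
      (k + ((y′ - y) * R + (z′ - z) * Q + (l - l′) * (Q * R))) * P ∎)
    where
    open ≡-Reasoning
    lem : ∀ P Q R x y z l m x′ y′ z′ l′ m′ → (x - x′) * (Q * R) ≡
      ((x * (Q * R) + y * (R * P) + z * (P * Q)) - (m + l * (P * Q * R))) - ((x′ * (Q * R) + y′ * (R * P) + z′ * (P * Q)) - (m′ + l′ * (P * Q * R)))
      + ((m - m′) + ((y′ - y) * R + (z′ - z) * Q + (l - l′) * (Q * R)) * P)
    lem = solve-∀

  y-unique : ∀ {m x y z l x′ y′ z′ l′} → Rep m x y z l → Rep m x′ y′ z′ l′ → y ≡ y′
  y-unique {m} {x} {y} {z} {l} {x′} {y′} {z′} {l′} (rep _ yr _ e) (rep _ yr′ _ e′) =
    inRange-unique ((x′ - x) * R + (z′ - z) * P + (l - l′) * (R * P)) (coprime-* qr (coprime-sym pq)) yr yr′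
    (begin
      (y - y′) * + (r ℕ.* p)  ≡⟨ cong ((y - y′) *_) (ℤₚ.pos-* r p) ⟩
      (y - y′) * (R * P)      ≡⟨ lem P Q R x y z l m x′ y′ z′ l′ ⟩
      _                       ≡⟨ difference e e′ ⟩
      ((x′ - x) * R + (z′ - z) * P + (l - l′) * (R * P)) * Q ∎)
    where
    open ≡-Reasoning
    lem : ∀ P Q R x y z l m x′ y′ z′ l′ → (y - y′) * (R * P) ≡
      ((x * (Q * R) + y * (R * P) + z * (P * Q)) - (m + l * (P * Q * R))) - ((x′ * (Q * R) + y′ * (R * P) + z′ * (P * Q)) - (m + l′ * (P * Q * R)))
      + ((x′ - x) * R + (z′ - z) * P + (l - l′) * (R * P)) * Q
    lem = solve-∀

  z-unique : ∀ {m x y z l x′ y′ z′ l′} → Rep m x y z l → Rep m x′ y′ z′ l′ → z ≡ z′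
  z-unique {m} {x} {y} {z} {l} {x′} {y′} {z′} {l′} (rep _ _ zr e) (rep _ _ zr′ e′) =
    inRange-unique ((x′ - x) * Q + (y′ - y) * P + (l - l′) * (P * Q)) (coprime-* (coprime-sym pr) (coprime-sym qr)) zr zr′
    (begin
      (z - z′) * + (p ℕ.* q)  ≡⟨ cong ((z - z′) *_) (ℤₚ.pos-* p q) ⟩
      (z - z′) * (P * Q)      ≡⟨ lem P Q R x y z l m x′ y′ z′ l′ ⟩
      _                       ≡⟨ difference e e′ ⟩
      ((x′ - x) * Q + (y′ - y) * P + (l - l′) * (P * Q)) * R ∎)
    where
    open ≡-Reasoning
    lem : ∀ P Q R x y z l m x′ y′ z′ l′ → (z - z′) * (P * Q) ≡
      ((x * (Q * R) + y * (R * P) + z * (P * Q)) - (m + l * (P * Q * R))) - ((x′ * (Q * R) + y′ * (R * P) + z′ * (P * Q)) - (m + l′ * (P * Q * R)))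
      + ((x′ - x) * Q + (y′ - y) * P + (l - l′) * (P * Q)) * R
    lem = solve-∀

  private
    0≤P : + 0 ≤ P
    0≤P = ℤ.+≤+ ℕ.z≤n
    0≤Q : + 0 ≤ Q
    0≤Q = ℤ.+≤+ ℕ.z≤n
    0≤R : + 0 ≤ R
    0≤R = ℤ.+≤+ ℕ.z≤n
    0≤N : + 0 ≤ N
    0≤N = 0≤* (0≤* 0≤P 0≤Q) 0≤R

    instance
      N≢0 : ℤ.NonZero N
      N≢0 = ℤₚ.i*j≢0 (P * Q) R {{ℤₚ.i*j≢0 P Q}}

  l-unique : ∀ {m x y z l x′ y′ z′ l′} → Rep m x y z l → Rep m x′ y′ z′ l′ → l ≡ l′
  l-unique {m} {l = l} {l′ = l′} ρ ρ′ =
    ℤₚ.*-cancelʳ-≡ l l′ N (+-cancelˡ m (l * N) (l′ * N) (trans (sym (Rep.equation ρ)) (trans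
      (cong₂ _+_ (cong₂ _+_ (cong (_* (Q * R)) (x-unique (+ 0) ρ ρ′ (ℤₚ.+-inverseʳ m)))
                            (cong (_* (R * P)) (y-unique ρ ρ′)))
                 (cong (_* (P * Q)) (z-unique ρ ρ′)))
      (Rep.equation ρ′))))

  -- The coordinates are nonnegative, hence so is m + l N. For k = 1 this makes levels nonnegative
  -- below N, for k = 0 it makes levels of negative numbers positive.
  level-bound : ∀ {m x y z l} k → Rep m x y z l → m < k * N → - k < l
  level-bound {m} {x} {y} {z} {l} k ρ m<kN with l ℤₚ.≤? - k
  ... | no  l≰-k = ℤₚ.≰⇒> l≰-k
  ... | yes l≤-k = ⊥-elim (-1≱0 (subst (+ 0 ≤_) (lem m l k N)
        (0≤+ (0≤+ 0≤E (<⇒0≤ m<kN)) (0≤* (≤⇒0≤ l≤-k) 0≤N))))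
    where
    open Rep ρ
    open InRange
    -1≱0 : + 0 ≤ -[1+ 0 ] → ⊥
    -1≱0 ()
    0≤E : + 0 ≤ m + l * N
    0≤E = subst (+ 0 ≤_) equation (0≤+ (0≤+ (0≤* (nonneg x-range) (0≤* 0≤Q 0≤R)) (0≤* (nonneg y-range) (0≤* 0≤R 0≤P))) (0≤* (nonneg z-range) (0≤* 0≤P 0≤Q)))
    lem : ∀ m l k N → (m + l * N) + (k * N - m - + 1) + (- k - l) * N ≡ -[1+ 0 ]
    lem = solve-∀

  level-nonneg : ∀ {m x y z l} → Rep m x y z l → m < N → + 0 ≤ l
  level-nonneg ρ m<N = ℤₚ.i<j⇒suc[i]≤j (level-bound (+ 1) ρ (subst (_ <_) (sym (ℤₚ.*-identityˡ N)) m<N))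

  private
    reduce : ∀ X p .{{_ : NonZero p}} → ∃[ x ] ∃[ k ] InRange x p × X ≡ x + k * + p
    reduce X p = + (X %ℕ p) , X /ℕ p , range (ℤ.+≤+ ℕ.z≤n) (ℤ.+<+ (n%ℕd<d X p)) , a≡a%ℕn+[a/ℕn]*n X p

    bézout₃ : ∃[ u ] ∃[ v ] ∃[ w ] u * (Q * R) + v * (R * P) + w * (P * Q) ≡ + 1
    bézout₃ =
      let a , b , ap+bq≡1  = bézout pq
          c , d , cr+dpq≡1 = bézout (coprime-* (coprime-sym pr) (coprime-sym qr))
      in c * b , c * a , d , (begin
        c * b * (Q * R) + c * a * (R * P) + d * (P * Q)   ≡⟨ lem P Q R a b c d ⟩
        c * R * (a * P + b * Q) + d * (P * Q)             ≡⟨ cong (λ i → c * R * i + d * (P * Q)) ap+bq≡1 ⟩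
        c * R * + 1 + d * (P * Q)                         ≡⟨ cong₂ (λ i j → i + d * j) (ℤₚ.*-identityʳ (c * R)) (sym (ℤₚ.pos-* p q)) ⟩
        c * R + d * + (p ℕ.* q)                           ≡⟨ cr+dpq≡1 ⟩
        + 1                                               ∎)
      where
      open ≡-Reasoning
      lem : ∀ P Q R a b c d → c * b * (Q * R) + c * a * (R * P) + d * (P * Q) ≡ c * R * (a * P + b * Q) + d * (P * Q)
      lem = solve-∀

    combine : ∀ P Q R m u v w x y z i j k → m * u ≡ x + i * P → m * v ≡ y + j * Q → m * w ≡ z + k * R →
      u * (Q * R) + v * (R * P) + w * (P * Q) ≡ + 1 →
      x * (Q * R) + y * (R * P) + z * (P * Q) ≡ m + - (i + j + k) * (P * Q * R)
    combine P Q R m u v w x y z i j k ex ey ez one = begin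
      x * (Q * R) + y * (R * P) + z * (P * Q)
        ≡⟨ lem₁ P Q R x y z i j k ⟩
      (x + i * P) * (Q * R) + (y + j * Q) * (R * P) + (z + k * R) * (P * Q) + L
        ≡⟨ cong (_+ L) (cong₂ _+_ (cong₂ _+_ (cong (_* (Q * R)) (sym ex)) (cong (_* (R * P)) (sym ey))) (cong (_* (P * Q)) (sym ez))) ⟩
      m * u * (Q * R) + m * v * (R * P) + m * w * (P * Q) + L
        ≡⟨ cong (_+ L) (lem₂ m u v w (Q * R) (R * P) (P * Q)) ⟩
      m * (u * (Q * R) + v * (R * P) + w * (P * Q)) + L
        ≡⟨ cong (λ i → m * i + L) one ⟩
      m * + 1 + L
        ≡⟨ cong (_+ L) (ℤₚ.*-identityʳ m) ⟩
      m + L ∎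
      where
      open ≡-Reasoning
      L = - (i + j + k) * (P * Q * R)
      lem₁ : ∀ P Q R x y z i j k → x * (Q * R) + y * (R * P) + z * (P * Q) ≡
        (x + i * P) * (Q * R) + (y + j * Q) * (R * P) + (z + k * R) * (P * Q) + - (i + j + k) * (P * Q * R)
      lem₁ = solve-∀
      lem₂ : ∀ m u v w a b c → m * u * a + m * v * b + m * w * c ≡ m * (u * a + v * b + w * c)
      lem₂ = solve-∀

  abstract
    -- The coefficients of a Bézout relation for 1 are scaled by m and reduced modulo p, q and r.
    -- Each reduction is absorbed by the level, because p · qr = q · rp = r · pq = N.
    coordinates : ∀ m → ∃[ x ] ∃[ y ] ∃[ z ] ∃[ l ] Rep m x y z l
    coordinates m =
      let u , v , w , one  = bézout₃
          x , i , xr , ex = reduce (m * u) p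
          y , j , yr , ey = reduce (m * v) q
          z , k , zr , ez = reduce (m * w) r
      in x , y , z , - (i + j + k) , rep xr yr zr (combine P Q R m u v w x y z i j k ex ey ez one)

  atCoordinates : (ℤ → ℤ → ℤ → ℤ → ℤ) → Seq
  atCoordinates F m = let x , y , z , l , _ = coordinates m in F x y z l

  atCoordinates-rep : ∀ F {m x y z l} → Rep m x y z l → atCoordinates F m ≡ F x y z l
  atCoordinates-rep F {m} ρ =
    let _ , _ , _ , _ , ρ′ = coordinates m
    in cong₄ (x-unique (+ 0) ρ′ ρ (ℤₚ.+-inverseʳ m)) (y-unique ρ′ ρ) (z-unique ρ′ ρ) (l-unique ρ′ ρ)
    where
    cong₄ : ∀ {x y z l x′ y′ z′ l′} → x ≡ x′ → y ≡ y′ → z ≡ z′ → l ≡ l′ → F x y z l ≡ F x′ y′ z′ l′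
    cong₄ refl refl refl refl = refl

  private
    -- The successive results of multiplying e by X^pq - 1, X^pr - 1 and X^qr - 1: each factor keeps
    -- only the points where one more coordinate is 0 and changes the sign.
    F₀ F₁ F₂ F₃ : ℤ → ℤ → ℤ → ℤ → ℤ
    F₀ x y z l = δ l
    F₁ x y z l = - (δ z * δ l)
    F₂ x y z l = δ z * δ y * δ l
    F₃ x y z l = - (δ z * δ y * δ x * δ l)

  -- For m < pqr this is the indicator of m = x qr + y rp + z pq with x, y, z ≥ 0; beyond
  -- that range levels may be negative.
  e : Seq
  e = atCoordinates F₀

  e-causal : Causal e
  e-causal n with coordinates -[1+ n ]
  ... | _ , _ , _ , _ , ρ = δ-positive (level-bound (+ 0) ρ (subst (-[1+ n ] <_) (sym (ℤₚ.*-zeroˡ N)) ℤ.-<+))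

  private
    predecessor : ∀ {x p} → InRange x p → x ≢ + 0 → InRange (x - + 1) p
    predecessor {+ zero}  _                      x≢0 = contradiction refl x≢0
    predecessor {+ suc x} (range _ (ℤ.+<+ 1+x<p)) _   = range (ℤ.+≤+ ℕ.z≤n) (ℤ.+<+ (ℕₚ.<-trans (ℕₚ.n<1+n x) 1+x<p))

    last : ∀ p .{{_ : NonZero p}} → InRange (+ p - + 1) p
    last (suc p) = range (ℤ.+≤+ ℕ.z≤n) (ℤ.+<+ (ℕₚ.n<1+n p))

    x-step : ∀ {m x y z l} → Rep m x y z l → x ≢ + 0 → Rep (m - Q * R) (x - + 1) y z l
    x-step {m} {x} {y} {z} {l} (rep xr yr zr eq) x≢0 = rep (predecessor xr x≢0) yr zr
      (trans (lem₁ P Q R x y z) (trans (cong (_- Q * R) eq) (lem₂ Q R m l N)))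
      where
      lem₁ : ∀ P Q R x y z → (x - + 1) * (Q * R) + y * (R * P) + z * (P * Q) ≡ x * (Q * R) + y * (R * P) + z * (P * Q) - Q * R
      lem₁ = solve-∀
      lem₂ : ∀ Q R m l N → m + l * N - Q * R ≡ m - Q * R + l * N
      lem₂ = solve-∀

    x-wrap : ∀ {m y z l} → Rep m (+ 0) y z l → Rep (m - Q * R) (P - + 1) y z (l + + 1)
    x-wrap {m} {y} {z} {l} (rep _ yr zr eq) = rep (last p) yr zr
      (trans (lem₁ P Q R y z) (trans (cong (λ i → i - Q * R + N) eq) (lem₂ Q R m l N)))
      where
      lem₁ : ∀ P Q R y z → (P - + 1) * (Q * R) + y * (R * P) + z * (P * Q) ≡ + 0 * (Q * R) + y * (R * P) + z * (P * Q) - Q * R + P * Q * R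
      lem₁ = solve-∀
      lem₂ : ∀ Q R m l N → m + l * N - Q * R + N ≡ m - Q * R + (l + + 1) * N
      lem₂ = solve-∀

    y-step : ∀ {m x y z l} → Rep m x y z l → y ≢ + 0 → Rep (m - P * R) x (y - + 1) z l
    y-step {m} {x} {y} {z} {l} (rep xr yr zr eq) y≢0 = rep xr (predecessor yr y≢0) zr
      (trans (lem₁ P Q R x y z) (trans (cong (_- P * R) eq) (lem₂ P R m l N)))
      where
      lem₁ : ∀ P Q R x y z → x * (Q * R) + (y - + 1) * (R * P) + z * (P * Q) ≡ x * (Q * R) + y * (R * P) + z * (P * Q) - P * R
      lem₁ = solve-∀
      lem₂ : ∀ Q R m l N → m + l * N - Q * R ≡ m - Q * R + l * N
      lem₂ = solve-∀

    y-wrap : ∀ {m x z l} → Rep m x (+ 0) z l → Rep (m - P * R) x (Q - + 1) z (l + + 1)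
    y-wrap {m} {x} {z} {l} (rep xr _ zr eq) = rep xr (last q) zr
      (trans (lem₁ P Q R x z) (trans (cong (λ i → i - P * R + N) eq) (lem₂ P R m l N)))
      where
      lem₁ : ∀ P Q R x z → x * (Q * R) + (Q - + 1) * (R * P) + z * (P * Q) ≡ x * (Q * R) + + 0 * (R * P) + z * (P * Q) - P * R + P * Q * R
      lem₁ = solve-∀
      lem₂ : ∀ Q R m l N → m + l * N - Q * R + N ≡ m - Q * R + (l + + 1) * N
      lem₂ = solve-∀

    z-step : ∀ {m x y z l} → Rep m x y z l → z ≢ + 0 → Rep (m - P * Q) x y (z - + 1) l
    z-step {m} {x} {y} {z} {l} (rep xr yr zr eq) z≢0 = rep xr yr (predecessor zr z≢0)
      (trans (lem₁ P Q R x y z) (trans (cong (_- P * Q) eq) (lem₂ P Q m l N)))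
      where
      lem₁ : ∀ P Q R x y z → x * (Q * R) + y * (R * P) + (z - + 1) * (P * Q) ≡ x * (Q * R) + y * (R * P) + z * (P * Q) - P * Q
      lem₁ = solve-∀
      lem₂ : ∀ Q R m l N → m + l * N - Q * R ≡ m - Q * R + l * N
      lem₂ = solve-∀

    z-wrap : ∀ {m x y l} → Rep m x y (+ 0) l → Rep (m - P * Q) x y (R - + 1) (l + + 1)
    z-wrap {m} {x} {y} {l} (rep xr yr _ eq) = rep xr yr (last r)
      (trans (lem₁ P Q R x y) (trans (cong (λ i → i - P * Q + N) eq) (lem₂ P Q m l N)))
      where
      lem₁ : ∀ P Q R x y → x * (Q * R) + y * (R * P) + (R - + 1) * (P * Q) ≡ x * (Q * R) + y * (R * P) + + 0 * (P * Q) - P * Q + P * Q * R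
      lem₁ = solve-∀
      lem₂ : ∀ Q R m l N → m + l * N - Q * R + N ≡ m - Q * R + (l + + 1) * N
      lem₂ = solve-∀

    -- After a wrap-around the level is at least 1, so the shifted term vanishes. Here m < N is
    -- essential, as beyond N a level may start out negative.
    δ-next : ∀ {l} → + 0 ≤ l → δ (l + + 1) ≡ + 0
    δ-next {+ l} _ = δ-positive (subst (+ 0 <_) (cong +_ (ℕₚ.+-comm 1 l)) (ℤ.+<+ ℕ.z<s))

    <N : ∀ {m} → m < + (p ℕ.* q ℕ.* r) → m < N
    <N = subst (_ <_) (sym N≡)

    shift-cong : ∀ a b F m → atCoordinates F (m - + (a ℕ.* b)) ≡ atCoordinates F (m - + a * + b)
    shift-cong a b F m = cong (λ i → atCoordinates F (m - i)) (ℤₚ.pos-* a b)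

    difference-of : ∀ a b F {i j} m → atCoordinates F (m - + a * + b) ≡ i → atCoordinates F m ≡ j →
      [X^ a ℕ.* b -1] (atCoordinates F) m ≡ i - j
    difference-of a b F m refl refl =
      trans (factor-1 (a ℕ.* b) (atCoordinates F) m) (cong (_- atCoordinates F m) (shift-cong a b F m))

    -- For z ≠ 0 subtracting pq lowers z and keeps the level, so the two terms cancel; for z = 0 it
    -- raises the level and only -δ l is left.
    z-factor : [X^ p ℕ.* q -1] e ≋ atCoordinates F₁ below (p ℕ.* q ℕ.* r)
    z-factor m m<N = let _ , _ , _ , _ , ρ = coordinates m in z-factor′ ρ m<N
      where
      z-factor′ : ∀ {m x y z l} → Rep m x y z l → m < + (p ℕ.* q ℕ.* r) → [X^ p ℕ.* q -1] e m ≡ F₁ x y z l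
      z-factor′ {m} {x} {y} {z} {l} ρ m<N with z ℤₚ.≟ + 0
      ... | yes refl = trans (difference-of p q F₀ m (atCoordinates-rep F₀ (z-wrap ρ)) (atCoordinates-rep F₀ ρ))
            (trans (cong (_- δ l) (δ-next (level-nonneg ρ (<N m<N)))) (lem (δ l)))
        where
        lem : ∀ i → + 0 - i ≡ - (+ 1 * i)
        lem = solve-∀
      ... | no z≢0 = trans (difference-of p q F₀ m (atCoordinates-rep F₀ (z-step ρ z≢0)) (atCoordinates-rep F₀ ρ))
            (trans (lem (δ l)) (cong (λ i → - (i * δ l)) (sym (δ-nonzero z≢0))))
        where
        lem : ∀ i → i - i ≡ - (+ 0 * i)
        lem = solve-∀

    y-factor : [X^ p ℕ.* r -1] (atCoordinates F₁) ≋ atCoordinates F₂ below (p ℕ.* q ℕ.* r)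
    y-factor m m<N = let _ , _ , _ , _ , ρ = coordinates m in y-factor′ ρ m<N
      where
      y-factor′ : ∀ {m x y z l} → Rep m x y z l → m < + (p ℕ.* q ℕ.* r) → [X^ p ℕ.* r -1] (atCoordinates F₁) m ≡ F₂ x y z l
      y-factor′ {m} {x} {y} {z} {l} ρ m<N with y ℤₚ.≟ + 0
      ... | yes refl = trans (difference-of p r F₁ m (atCoordinates-rep F₁ (y-wrap ρ)) (atCoordinates-rep F₁ ρ))
            (trans (cong (λ i → - (δ z * i) - - (δ z * δ l)) (δ-next (level-nonneg ρ (<N m<N)))) (lem (δ z) (δ l)))
        where
        lem : ∀ z l → - (z * + 0) - - (z * l) ≡ z * + 1 * l
        lem = solve-∀
      ... | no y≢0 = trans (difference-of p r F₁ m (atCoordinates-rep F₁ (y-step ρ y≢0)) (atCoordinates-rep F₁ ρ))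
            (trans (lem (δ z) (δ l)) (cong (λ i → δ z * i * δ l) (sym (δ-nonzero y≢0))))
        where
        lem : ∀ z l → - (z * l) - - (z * l) ≡ z * + 0 * l
        lem = solve-∀

    x-factor : [X^ q ℕ.* r -1] (atCoordinates F₂) ≋ atCoordinates F₃ below (p ℕ.* q ℕ.* r)
    x-factor m m<N = let _ , _ , _ , _ , ρ = coordinates m in x-factor′ ρ m<N
      where
      x-factor′ : ∀ {m x y z l} → Rep m x y z l → m < + (p ℕ.* q ℕ.* r) → [X^ q ℕ.* r -1] (atCoordinates F₂) m ≡ F₃ x y z l
      x-factor′ {m} {x} {y} {z} {l} ρ m<N with x ℤₚ.≟ + 0
      ... | yes refl = trans (difference-of q r F₂ m (atCoordinates-rep F₂ (x-wrap ρ)) (atCoordinates-rep F₂ ρ))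
            (trans (cong (λ i → δ z * δ y * i - δ z * δ y * δ l) (δ-next (level-nonneg ρ (<N m<N)))) (lem (δ z * δ y) (δ l)))
        where
        lem : ∀ z l → z * + 0 - z * l ≡ - (z * + 1 * l)
        lem = solve-∀
      ... | no x≢0 = trans (difference-of q r F₂ m (atCoordinates-rep F₂ (x-step ρ x≢0)) (atCoordinates-rep F₂ ρ))
            (trans (lem (δ z * δ y) (δ l)) (cong (λ i → - (δ z * δ y * i * δ l)) (sym (δ-nonzero x≢0))))
        where
        lem : ∀ z l → z * l - z * l ≡ - (z * + 0 * l)
        lem = solve-∀

    origin : Rep (+ 0) (+ 0) (+ 0) (+ 0) (+ 0)
    origin = rep (zeroInRange p) (zeroInRange q) (zeroInRange r) (lem P Q R)
      where
      zeroInRange : ∀ p .{{_ : NonZero p}} → InRange (+ 0) p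
      zeroInRange (suc p) = range (ℤ.+≤+ ℕ.z≤n) (ℤ.+<+ ℕ.z<s)
      lem : ∀ P Q R → + 0 * (Q * R) + + 0 * (R * P) + + 0 * (P * Q) ≡ + 0 + + 0 * (P * Q * R)
      lem = solve-∀

    F₃-origin : atCoordinates F₃ ≋ (λ m → - δ m)
    F₃-origin m with m ℤₚ.≟ + 0
    ... | yes refl = atCoordinates-rep F₃ origin
    ... | no  m≢0  = let _ , _ , _ , _ , ρ = coordinates m in away ρ m≢0
      where
      away : ∀ {m x y z l} → Rep m x y z l → m ≢ + 0 → F₃ x y z l ≡ - δ m
      away {m} {x} {y} {z} {l} ρ m≢0 with x ℤₚ.≟ + 0 | y ℤₚ.≟ + 0 | z ℤₚ.≟ + 0 | l ℤₚ.≟ + 0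
      ... | yes refl | yes refl | yes refl | yes refl = contradiction
            (trans (sym (trans (cong (λ i → m + i) (ℤₚ.*-zeroˡ N)) (ℤₚ.+-identityʳ m))) (trans (sym (Rep.equation ρ)) (zeros P Q R))) m≢0
        where
        zeros : ∀ P Q R → + 0 * (Q * R) + + 0 * (R * P) + + 0 * (P * Q) ≡ + 0
        zeros = solve-∀
      ... | no x≢0 | _ | _ | _ rewrite δ-nonzero x≢0 | δ-nonzero m≢0 = lem (δ z) (δ y) (δ l)
        where
        lem : ∀ z y l → - (z * y * + 0 * l) ≡ - + 0
        lem = solve-∀
      ... | yes _ | no y≢0 | _ | _ rewrite δ-nonzero y≢0 | δ-nonzero m≢0 = lem (δ z) (δ x) (δ l)
        where
        lem : ∀ z y l → - (z * + 0 * y * l) ≡ - + 0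
        lem = solve-∀
      ... | yes _ | yes _ | no z≢0 | _ rewrite δ-nonzero z≢0 | δ-nonzero m≢0 = lem (δ y) (δ x) (δ l)
        where
        lem : ∀ z y l → - (+ 0 * z * y * l) ≡ - + 0
        lem = solve-∀
      ... | yes _ | yes _ | yes _ | no l≢0 rewrite δ-nonzero l≢0 | δ-nonzero m≢0 = lem (δ z) (δ y) (δ x)
        where
        lem : ∀ z y x → - (z * y * x * + 0) ≡ - + 0
        lem = solve-∀

  e-rep : ∀ {m x y z l} → Rep m x y z l → e m ≡ δ l
  e-rep = atCoordinates-rep F₀

  -- The three factors reduce e to -δ, and below N this is the same as (X^N - 1) δ.
  e-generating : factors (q ℕ.* r ∷ p ℕ.* r ∷ p ℕ.* q ∷ []) e ≋ [X^ p ℕ.* q ℕ.* r -1] δ below (p ℕ.* q ℕ.* r)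
  e-generating m m<N = begin
    factors (q ℕ.* r ∷ p ℕ.* r ∷ p ℕ.* q ∷ []) e m
      ≡⟨ factors-cong-below (q ℕ.* r ∷ p ℕ.* r ∷ []) _ _ _ z-factor m m<N ⟩
    factors (q ℕ.* r ∷ p ℕ.* r ∷ []) (atCoordinates F₁) m
      ≡⟨ factors-cong-below (q ℕ.* r ∷ []) _ _ _ y-factor m m<N ⟩
    [X^ q ℕ.* r -1] (atCoordinates F₂) m  ≡⟨ x-factor m m<N ⟩
    atCoordinates F₃ m                    ≡⟨ F₃-origin m ⟩
    - δ m                                 ≡⟨ ℤₚ.+-identityˡ (- δ m) ⟨
    + 0 - δ m                             ≡⟨ cong (_- δ m) (δ-nonzero (λ eq → ℤₚ.<-irrefl (ℤₚ.i-j≡0⇒i≡j m _ eq) m<N)) ⟨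
    δ (m - + (p ℕ.* q ℕ.* r)) - δ m       ≡⟨ factor-1 (p ℕ.* q ℕ.* r) δ m ⟨
    [X^ p ℕ.* q ℕ.* r -1] δ m             ∎
    where open ≡-Reasoning

-- Counting in a window

-- An injection from `Fin n` rather than a list, so that the pigeonhole principle applies directly.
record Selection (k : ℕ) (B : ℕ → Set) (n : ℕ) : Set where
  field
    element   : Fin n → ℕ
    injective : ∀ {i j} → element i ≡ element j → i ≡ j
    bounded   : ∀ i → element i ℕ.< k
    selected  : ∀ i → B (element i)

empty : ∀ {B} → Selection 0 B 0
empty = record { element = λ (); injective = λ {}; bounded = λ (); selected = λ () }

skip : ∀ {k B n} → Selection k B n → Selection (suc k) B n
skip σ = record { Selection σ; bounded = λ i → ℕₚ.m≤n⇒m≤1+n (Selection.bounded σ i) }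

select : ∀ {k B n} → B k → Selection k B n → Selection (suc k) B (suc n)
select {k} {B} {n} b σ = record
  { element   = element′
  ; injective = injective′
  ; bounded   = λ { zero → ℕₚ.n<1+n k ; (suc i) → ℕₚ.m≤n⇒m≤1+n (bounded i) }
  ; selected  = λ { zero → b ; (suc i) → selected i }
  }
  where
  open Selection σ
  element′ : Fin (suc n) → ℕ
  element′ zero    = k
  element′ (suc i) = element i
  injective′ : ∀ {i j} → element′ i ≡ element′ j → i ≡ j
  injective′ {zero}  {zero}  _  = refl
  injective′ {zero}  {suc j} eq = contradiction (sym eq) (ℕₚ.<⇒≢ (bounded j))
  injective′ {suc i} {zero}  eq = contradiction eq (ℕₚ.<⇒≢ (bounded i))
  injective′ {suc i} {suc j} eq = cong suc (injective eq)

residue-gap : ∀ L .{{_ : NonZero L}} {m n} → m % L ≡ n % L → m / L ℕ.< n / L → m ℕ.+ L ℕ.≤ n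
residue-gap L {m} {n} eq lt = begin
  m ℕ.+ L                               ≡⟨ cong (ℕ._+ L) (m≡m%n+[m/n]*n m L) ⟩
  (m % L ℕ.+ m / L ℕ.* L) ℕ.+ L         ≡⟨ ℕₚ.+-assoc (m % L) _ L ⟩
  m % L ℕ.+ (m / L ℕ.* L ℕ.+ L)         ≡⟨ cong₂ ℕ._+_ eq (ℕₚ.+-comm _ L) ⟩
  n % L ℕ.+ suc (m / L) ℕ.* L           ≤⟨ ℕₚ.+-monoʳ-≤ (n % L) (ℕₚ.*-monoˡ-≤ L lt) ⟩
  n % L ℕ.+ n / L ℕ.* L                 ≡⟨ m≡m%n+[m/n]*n n L ⟨
  n                                     ∎
  where open ℕₚ.≤-Reasoning

close-residues : ∀ L .{{_ : NonZero L}} {m n} → m % L ≡ n % L → m ℕ.< n ℕ.+ L → n ℕ.< m ℕ.+ L → m ≡ n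
close-residues L {m} {n} eq m<n+L n<m+L with ℕₚ.<-cmp (m / L) (n / L)
... | tri≈ _ m/L≡n/L _ = trans (m≡m%n+[m/n]*n m L) (trans (cong₂ (λ i j → i ℕ.+ j ℕ.* L) eq m/L≡n/L) (sym (m≡m%n+[m/n]*n n L)))
... | tri< m/L<n/L _ _ = contradiction n<m+L (ℕₚ.≤⇒≯ (residue-gap L {m} {n} eq m/L<n/L))
... | tri> _ _ n/L<m/L = contradiction m<n+L (ℕₚ.≤⇒≯ (residue-gap L {n} {m} (sym eq) n/L<m/L))

module Counting (k : ℕ) (x : ℕ → ℤ) (x≥0 : ∀ i → + 0 ≤ x i)
  (x-injective : ∀ {i j} → i ℕ.< k → j ℕ.< k → x i ≡ x j → i ≡ j) where

  -- A pairwise condition instead of a containing interval: comparing two points of equal level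
  -- bounds x - x′ but gives no endpoints.
  Spread : (ℕ → Set) → ℕ → Set
  Spread B L = ∀ {i j} → i ℕ.< k → j ℕ.< k → B i → B j → x i < x j + + L

  -- Values spread over less than L are determined by their residues modulo L.
  capacity : ∀ {B L n} → Spread B L → Selection k B n → n ℕ.≤ L
  capacity {B} {zero} {zero}  spread σ = ℕ.z≤n
  capacity {B} {zero} {suc n} spread σ = contradiction
    (spread (bounded zero) (bounded zero) (selected zero) (selected zero))
    (ℤₚ.<-irrefl (sym (ℤₚ.+-identityʳ _)))
    where open Selection σ
  capacity {B} {L@(suc _)} {n} spread σ = injective⇒≤ {f = λ i → fromℕ< (m%n<n ∣ x (element i) ∣ L)}
    λ {i} {j} eq → injective (x-injective (bounded i) (bounded j)
      (same i j (close-residues L (fromℕ<-injective _ _ (m%n<n ∣ x (element i) ∣ L) (m%n<n ∣ x (element j) ∣ L) eq) (near i j) (near j i))))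
    where
    open Selection σ
    same : ∀ i j → ∣ x (element i) ∣ ≡ ∣ x (element j) ∣ → x (element i) ≡ x (element j)
    same i j eq = trans (sym (ℤₚ.0≤i⇒+∣i∣≡i (x≥0 _))) (trans (cong +_ eq) (ℤₚ.0≤i⇒+∣i∣≡i (x≥0 _)))
    near : ∀ i j → ∣ x (element i) ∣ ℕ.< ∣ x (element j) ∣ ℕ.+ L
    near i j = ℤₚ.drop‿+<+ (subst (_< + (∣ x (element j) ∣ ℕ.+ L)) (sym (ℤₚ.0≤i⇒+∣i∣≡i (x≥0 _)))
      (subst (λ y → x (element i) < y + + L) (sym (ℤₚ.0≤i⇒+∣i∣≡i (x≥0 _))) (spread (bounded i) (bounded j) (selected i) (selected j))))

  -- Only indices in B or C contribute, each at most 1, and `capacity` bounds how many there are.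
  -- Two sets are needed because the x with a given sign of S form two pieces bounded by different
  -- arguments.
  box-count : ∀ f n {B C L M} → (∀ i → f (n - + i) ≤ + 0 ⊎ (f (n - + i) ≤ + 1 × (B i ⊎ C i))) →
    Spread B L → Spread C M → box k f n ≤ + (L ℕ.+ M)
  box-count f n {B} {C} class B-spread C-spread with choose k
    where
    choose : ∀ k → ∃[ l ] ∃[ m ] Selection k B l × Selection k C m × box k f n ≤ + (l ℕ.+ m)
    choose zero    = 0 , 0 , empty , empty , ℤ.+≤+ ℕ.z≤n
    choose (suc k) with choose k | class k
    ... | l , m , σ , τ , box≤ | inj₁ f≤0 = l , m , skip σ , skip τ ,
          ℤₚ.≤-trans (ℤₚ.+-mono-≤ box≤ f≤0) (ℤₚ.≤-reflexive (ℤₚ.+-identityʳ _))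
    ... | l , m , σ , τ , box≤ | inj₂ (f≤1 , inj₁ b) = suc l , m , select b σ , skip τ ,
          ℤₚ.≤-trans (ℤₚ.+-mono-≤ box≤ f≤1) (ℤₚ.≤-reflexive (cong +_ (ℕₚ.+-comm (l ℕ.+ m) 1)))
    ... | l , m , σ , τ , box≤ | inj₂ (f≤1 , inj₂ c) = l , suc m , skip σ , select c τ ,
          ℤₚ.≤-trans (ℤₚ.+-mono-≤ box≤ f≤1) (ℤₚ.≤-reflexive (cong +_ (trans (ℕₚ.+-comm (l ℕ.+ m) 1) (sym (ℕₚ.+-suc l m)))))
  ... | l , m , σ , τ , box≤ = ℤₚ.≤-trans box≤ (ℤ.+≤+ (ℕₚ.+-mono-≤ (capacity B-spread σ) (capacity C-spread τ)))

box-neg : ∀ k f n → box k (λ m → - f m) n ≡ - box k f n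
box-neg zero    f n = refl
box-neg (suc k) f n = trans (cong (_+ - f (n - + k)) (box-neg k f n)) (sym (ℤₚ.neg-distrib-+ (box k f n) (f (n - + k))))

-- Bounds on the coefficients

-- The value of e(m-q-r) - e(m-q) - e(m-r) + e(m) when m has level l.  The bits record
-- wrap-arounds: i and j of x when passing to m-r and m-q, k of x when passing on from m-q
-- to m-q-r, s of y when subtracting r, and t of z when subtracting q.
σ : (i j k s t l : ℕ) → ℤ
σ i j k s t l =
  (δ (+ (l ℕ.+ (j ℕ.+ t) ℕ.+ (k ℕ.+ s)) - + 2) - δ (+ (l ℕ.+ (j ℕ.+ t)) - + 1))
  - (δ (+ (l ℕ.+ (i ℕ.+ s)) - + 1) - δ (+ l))

-- Nonnegativity of the levels of m - r, m - q and m - q - r, which lie below N with m. It matters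
-- for the signs: i = j = 1 and k = s = t = l = 0 would give -1 where a nonnegative value is
-- claimed.
Admissible : (i j k s t l : ℕ) → Set
Admissible i j k s t l =
  1 ℕ.≤ l ℕ.+ (i ℕ.+ s) × 1 ℕ.≤ l ℕ.+ (j ℕ.+ t) × 2 ℕ.≤ l ℕ.+ (j ℕ.+ t) ℕ.+ (k ℕ.+ s)

-- E is the information gained when the value is not merely on the harmless side of 0.
AtMost AtLeast : ℤ → Set → Set
AtMost  v E = v ≤ + 0 ⊎ (v ≤ + 1 × E)
AtLeast v E = + 0 ≤ v ⊎ (-[1+ 0 ] ≤ v × E)

Positive Negative : (i j k : ℕ) → (ℕ → ℕ → ℕ → Set) → ℕ → ℕ → ℕ → Set
Positive i j k E s t l = Admissible i j k s t l → + 0 ≤ σ i j k s t l × AtMost (σ i j k s t l) (E s t l)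
Negative i j k E s t l = Admissible i j k s t l → σ i j k s t l ≤ + 0 × AtLeast (σ i j k s t l) (E s t l)

Anywhere : ℕ → ℕ → ℕ → Set
Anywhere s t l = ⊤

Only : (s t l s′ t′ l′ : ℕ) → Set
Only s t l s′ t′ l′ = l′ ≡ l × s′ ≡ s × t′ ≡ t

private
  admissible? : ∀ i j k s t l → Dec (Admissible i j k s t l)
  admissible? i j k s t l = (_ ℕₚ.≤? _) ×-dec (_ ℕₚ.≤? _) ×-dec (_ ℕₚ.≤? _)

  positive? : ∀ i j k {E} → (∀ s t l → Dec (E s t l)) → Dec (∀ (s t : Fin 2) (l : Fin 3) → Positive i j k E (toℕ s) (toℕ t) (toℕ l))
  positive? i j k E? = all? λ s → all? λ t → all? λ l → admissible? i j k (toℕ s) (toℕ t) (toℕ l) →-dec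
    ((_ ℤₚ.≤? _) ×-dec ((_ ℤₚ.≤? _) ⊎-dec ((_ ℤₚ.≤? _) ×-dec E? (toℕ s) (toℕ t) (toℕ l))))

  negative? : ∀ i j k {E} → (∀ s t l → Dec (E s t l)) → Dec (∀ (s t : Fin 2) (l : Fin 3) → Negative i j k E (toℕ s) (toℕ t) (toℕ l))
  negative? i j k E? = all? λ s → all? λ t → all? λ l → admissible? i j k (toℕ s) (toℕ t) (toℕ l) →-dec
    ((_ ℤₚ.≤? _) ×-dec ((_ ℤₚ.≤? _) ⊎-dec ((_ ℤₚ.≤? _) ×-dec E? (toℕ s) (toℕ t) (toℕ l))))

  anywhere? : ∀ s t l → Dec (Anywhere s t l)
  anywhere? s t l = yes tt

  only? : ∀ s t l s′ t′ l′ → Dec (Only s t l s′ t′ l′)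
  only? s t l s′ t′ l′ = (l′ ℕₚ.≟ l) ×-dec (s′ ℕₚ.≟ s) ×-dec (t′ ℕₚ.≟ t)

  all-levels : ∀ {T : ℕ → Set} → (∀ (l : Fin 3) → T (toℕ l)) → (∀ l → T (3 ℕ.+ l)) → ∀ l → T l
  all-levels low high 0 = low 0F
  all-levels low high 1 = low 1F
  all-levels low high 2 = low 2F
  all-levels low high (suc (suc (suc l))) = high l

  0≤0 : + 0 ≤ + 0
  0≤0 = ℤ.+≤+ ℕ.z≤n

  -- From level 3 on every argument of δ in `σ` is positive and `σ` vanishes, so a finite table
  -- suffices.
  positive-everywhere : ∀ i j k {E} → (∀ (s t : Fin 2) (l : Fin 3) → Positive i j k E (toℕ s) (toℕ t) (toℕ l)) →
    ∀ (s t : Fin 2) l → Positive i j k E (toℕ s) (toℕ t) l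
  positive-everywhere i j k {E} table s t = all-levels {λ l → Positive i j k E (toℕ s) (toℕ t) l} (table s t) λ l _ → 0≤0 , inj₁ 0≤0

  negative-everywhere : ∀ i j k {E} → (∀ (s t : Fin 2) (l : Fin 3) → Negative i j k E (toℕ s) (toℕ t) (toℕ l)) →
    ∀ (s t : Fin 2) l → Negative i j k E (toℕ s) (toℕ t) l
  negative-everywhere i j k {E} table s t = all-levels {λ l → Negative i j k E (toℕ s) (toℕ t) l} (table s t) λ l _ → 0≤0 , inj₁ 0≤0

-- The digits are i, j, k. The patterns 110 and 001 occur on x-intervals of length α, where counting
-- x is enough. In each of the other four at most one triple s, t, l gives a nonzero value, and
-- `Only` records it.
σ-110 : ∀ (s t : Fin 2) l → Positive 1 1 0 Anywhere (toℕ s) (toℕ t) l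
σ-110 = positive-everywhere 1 1 0 {Anywhere} (from-yes (positive? 1 1 0 {Anywhere} anywhere?))

σ-001 : ∀ (s t : Fin 2) l → Negative 0 0 1 Anywhere (toℕ s) (toℕ t) l
σ-001 = negative-everywhere 0 0 1 {Anywhere} (from-yes (negative? 0 0 1 {Anywhere} anywhere?))

σ-000 : ∀ (s t : Fin 2) l → Positive 0 0 0 (Only 0 0 2) (toℕ s) (toℕ t) l
σ-000 = positive-everywhere 0 0 0 {Only 0 0 2} (from-yes (positive? 0 0 0 {Only 0 0 2} (only? 0 0 2)))

σ-010 : ∀ (s t : Fin 2) l → Negative 0 1 0 (Only 0 1 1) (toℕ s) (toℕ t) l
σ-010 = negative-everywhere 0 1 0 {Only 0 1 1} (from-yes (negative? 0 1 0 {Only 0 1 1} (only? 0 1 1)))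

σ-111 : ∀ (s t : Fin 2) l → Positive 1 1 1 (Only 1 1 0) (toℕ s) (toℕ t) l
σ-111 = positive-everywhere 1 1 1 {Only 1 1 0} (from-yes (positive? 1 1 1 {Only 1 1 0} (only? 1 1 0)))

σ-101 : ∀ (s t : Fin 2) l → Negative 1 0 1 (Only 1 0 1) (toℕ s) (toℕ t) l
σ-101 = negative-everywhere 1 0 1 {Only 1 0 1} (from-yes (negative? 1 0 1 {Only 1 0 1} (only? 1 0 1)))

-- Cyclic shifts of a coordinate, and widths of the intervals for y and z

wrapped : ∀ {x p a} → a ℕ.≤ p → InRange x p → x < + a → InRange (x - + a + + 1 * + p) p
wrapped {x} {p} {a} a≤p (range 0≤x x<p) x<a = range
  (≤-slack _ (lem₁ x (+ p) (+ a)) (0≤+ 0≤x (≤⇒0≤ (ℤ.+≤+ a≤p))))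
  (<-slack _ (lem₂ x (+ p) (+ a)) (<⇒0≤ x<a))
  where
  lem₁ : ∀ x p a → (x - a + + 1 * p) - + 0 ≡ x + (p - a)
  lem₁ = solve-∀
  lem₂ : ∀ x p a → p - (x - a + + 1 * p) - + 1 ≡ a - x - + 1
  lem₂ = solve-∀

unwrapped : ∀ {x p} a → InRange x p → + a ≤ x → InRange (x - + a + + 0 * + p) p
unwrapped {x} {p} a (range 0≤x x<p) a≤x = range
  (≤-slack _ (lem₁ x (+ p) (+ a)) (≤⇒0≤ a≤x))
  (<-slack _ (lem₂ x (+ p) (+ a)) (0≤+ (<⇒0≤ x<p) (ℤ.+≤+ (ℕ.z≤n {a}))))
  where
  lem₁ : ∀ x p a → (x - a + + 0 * p) - + 0 ≡ x - a
  lem₁ = solve-∀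
  lem₂ : ∀ x p a → p - (x - a + + 0 * p) - + 1 ≡ (p - x - + 1) + a
  lem₂ = solve-∀

wrap? : ∀ {x p a} → a ℕ.≤ p → InRange x p →
  ∃[ s ] InRange (x - + a + + toℕ {2} s * + p) p × (toℕ s ≡ 0 → + a ≤ x) × (toℕ s ≡ 1 → x < + a)
wrap? {x} {p} {a} a≤p xr with x ℤₚ.<? + a
... | yes x<a = 1F , wrapped a≤p xr x<a , (λ ()) , (λ _ → x<a)
... | no  x≮a = 0F , unwrapped a xr (ℤₚ.≮⇒≥ x≮a) , (λ _ → ℤₚ.≮⇒≥ x≮a) , (λ ())

positive-verdict : ∀ {v w E U L} → w ≡ v → + 0 ≤ v × AtMost v E → (E → U) → AtMost w U × AtLeast w L
positive-verdict refl (0≤v , inj₁ v≤0)       f = inj₁ v≤0 , inj₁ 0≤v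
positive-verdict refl (0≤v , inj₂ (v≤1 , e)) f = inj₂ (v≤1 , f e) , inj₁ 0≤v

negative-verdict : ∀ {v w E U L} → w ≡ v → v ≤ + 0 × AtLeast v E → (E → L) → AtMost w U × AtLeast w L
negative-verdict refl (v≤0 , inj₁ 0≤v)        f = inj₁ v≤0 , inj₁ 0≤v
negative-verdict refl (v≤0 , inj₂ (-1≤v , e)) f = inj₁ v≤0 , inj₂ (-1≤v , f e)

AtLeast⇒AtMost : ∀ {v E} → AtLeast v E → AtMost (- v) E
AtLeast⇒AtMost (inj₁ 0≤v)        = inj₁ (ℤₚ.neg-mono-≤ 0≤v)
AtLeast⇒AtMost (inj₂ (-1≤v , e)) = inj₂ (ℤₚ.neg-mono-≤ -1≤v , e)

pos-∸ : ∀ {m n} → n ℕ.≤ m → + (m ℕ.∸ n) ≡ + m - + n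
pos-∸ {m} {n} n≤m = sym (trans (ℤₚ.m-n≡m⊖n m n) (ℤₚ.⊖-≥ n≤m))

0≤pos : ∀ n → + 0 ≤ + n
0≤pos _ = ℤ.+≤+ ℕ.z≤n

module _ (p q q′ b : ℕ) (inverse : + q′ * + q + + b * + p ≡ + 1 + + p * + q) {y y′ : ℤ}
  (y-range : InRange y q) (y′-range : InRange y′ q) where

  open InRange

  -- By `inverse`, p(q - b) = q q′ - 1, so the interval [b, q) gives a bound smaller by 2. The
  -- constant is that of `width-below`, where p b = q(p - q′) + 1 makes it exact; both then fit the
  -- same inequality with q′ or p - q′ for h.
  width-above : + b ≤ y → + p * (y′ - y) ≤ + q * + q′ - + p + + 1
  width-above b≤y = ≤-slack _
    (trans (lem (+ p) (+ q) (+ q′) (+ b) y y′) (cong (λ i → + p * (+ q - y′ - + 1) + + p * (y - + b) + + 2 + i) (ℤₚ.i≡j⇒i-j≡0 inverse)))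
    (0≤+ (0≤+ (0≤+ (0≤* (0≤pos p) (<⇒0≤ (bounded y′-range))) (0≤* (0≤pos p) (≤⇒0≤ b≤y))) (0≤pos 2)) (0≤pos 0))
    where
    lem : ∀ p q q′ b y y′ → (q * q′ - p + + 1) - p * (y′ - y) ≡
      p * (q - y′ - + 1) + p * (y - b) + + 2 + ((q′ * q + b * p) - (+ 1 + p * q))
    lem = solve-∀

  width-below : y′ < + b → + p * (y′ - y) ≤ + q * (+ p - + q′) - + p + + 1
  width-below y′<b = ≤-slack _
    (trans (lem (+ p) (+ q) (+ q′) (+ b) y y′) (cong (λ i → + p * (+ b - y′ - + 1) + + p * y - i) (ℤₚ.i≡j⇒i-j≡0 inverse)))
    (0≤+ (0≤+ (0≤* (0≤pos p) (<⇒0≤ y′<b)) (0≤* (0≤pos p) (nonneg y-range))) (0≤pos 0))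
    where
    lem : ∀ p q q′ b y y′ → (q * (p - q′) - p + + 1) - p * (y′ - y) ≡
      p * (b - y′ - + 1) + p * y - ((q′ * q + b * p) - (+ 1 + p * q))
    lem = solve-∀

-- q-inverse and r-inverse make b and c the inverses of p modulo q and r.
module Bounds (p q r : ℕ) {{_ : NonZero p}} {{_ : NonZero q}} {{_ : NonZero r}}
  (pq : Coprime p q) (pr : Coprime p r) (qr : Coprime q r)
  (q′ r′ b c : ℕ) (q′≤p : q′ ℕ.≤ p) (r′≤p : r′ ℕ.≤ p) (b≤q : b ℕ.≤ q) (c≤r : c ℕ.≤ r)
  (q-inverse : + q′ * + q + + b * + p ≡ + 1 + + p * + q)
  (r-inverse : + r′ * + r + + c * + p ≡ + 1 + + p * + r) where

  open Lattice p q r pq pr qr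

  -- Multiplying `q-inverse` by r gives q′ qr + b rp = r + N. Subtracting r thus costs q′ in x, b in
  -- y and 1 in the level, and each wrap-around returns 1 to the level.
  shift-r : ∀ {m x y z l} i s → Rep m x y z l →
    InRange (x - + q′ + + i * P) p → InRange (y - + b + + s * Q) q →
    Rep (m - R) (x - + q′ + + i * P) (y - + b + + s * Q) z (l + + (i ℕ.+ s) - + 1)
  shift-r {m} {x} {y} {z} {l} i s (rep _ _ zr eq) xr yr = rep xr yr zr
    (trans (lem₁ P Q R (+ q′) (+ b) x y z (+ i) (+ s))
    (trans (cong₂ (λ u v → u - R * v + (+ i + + s) * N) eq q-inverse)
           (lem₂ P Q R m l (+ i) (+ s))))
    where
    lem₁ : ∀ P Q R q′ b x y z i s →
      (x - q′ + i * P) * (Q * R) + (y - b + s * Q) * (R * P) + z * (P * Q)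
      ≡ (x * (Q * R) + y * (R * P) + z * (P * Q)) - R * (q′ * Q + b * P) + (i + s) * (P * Q * R)
    lem₁ = solve-∀
    lem₂ : ∀ P Q R m l i s →
      (m + l * (P * Q * R)) - R * (+ 1 + P * Q) + (i + s) * (P * Q * R) ≡ m - R + (l + (i + s) - + 1) * (P * Q * R)
    lem₂ = solve-∀

  shift-q : ∀ {m x y z l} j t → Rep m x y z l →
    InRange (x - + r′ + + j * P) p → InRange (z - + c + + t * R) r →
    Rep (m - Q) (x - + r′ + + j * P) y (z - + c + + t * R) (l + + (j ℕ.+ t) - + 1)
  shift-q {m} {x} {y} {z} {l} j t (rep _ yr _ eq) xr zr = rep xr yr zr
    (trans (lem₁ P Q R (+ r′) (+ c) x y z (+ j) (+ t))
    (trans (cong₂ (λ u v → u - Q * v + (+ j + + t) * N) eq r-inverse)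
           (lem₂ P Q R m l (+ j) (+ t))))
    where
    lem₁ : ∀ P Q R r′ c x y z j t →
      (x - r′ + j * P) * (Q * R) + y * (R * P) + (z - c + t * R) * (P * Q)
      ≡ (x * (Q * R) + y * (R * P) + z * (P * Q)) - Q * (r′ * R + c * P) + (j + t) * (P * Q * R)
    lem₁ = solve-∀
    lem₂ : ∀ P Q R m l j t →
      (m + l * (P * Q * R)) - Q * (+ 1 + P * R) + (j + t) * (P * Q * R) ≡ m - Q + (l + (j + t) - + 1) * (P * Q * R)
    lem₂ = solve-∀

  S : Seq
  S = factors (q ∷ r ∷ []) e

  S-expand : ∀ m → S m ≡ (e (m - Q - R) - e (m - Q)) - (e (m - R) - e m)
  S-expand m = trans (factor-1 q (factors (r ∷ []) e) m) (cong₂ _-_ (factor-1 r e (m - Q)) (factor-1 r e m))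

  private
    -<N : ∀ {m} k → m < N → m - + k < N
    -<N {m} k m<N = ℤₚ.≤-<-trans (ℤₚ.i-j≤i m (+ k)) m<N

    level-≥ : ∀ {n k} → + 0 ≤ + n - + k → k ℕ.≤ n
    level-≥ 0≤ = ℤₚ.drop‿+≤+ (ℤₚ.0≤i-j⇒j≤i 0≤)

  S-value : ∀ {m x y z l} i j k s t → Rep m x y z l → m < N →
    InRange (x - + q′ + + i * P) p → InRange (x - + r′ + + j * P) p →
    InRange (x - + r′ + + j * P - + q′ + + k * P) p →
    InRange (y - + b + + s * Q) q → InRange (z - + c + + t * R) r →
    ∃[ ℓ ] l ≡ + ℓ × Admissible i j k s t ℓ × S m ≡ σ i j k s t ℓ
  S-value {m} {l = + ℓ} i j k s t ρ m<N xi xj xk ys zt =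
    ℓ , refl ,
    (level-≥ (level-nonneg ρr (-<N r m<N)) , level-≥ (level-nonneg ρq (-<N q m<N)) ,
      level-≥ (subst (+ 0 ≤_) combine-levels (level-nonneg ρqr (-<N r (-<N q m<N))))) ,
    trans (S-expand m) (cong₂ _-_ (cong₂ _-_ (trans (e-rep ρqr) (cong δ combine-levels)) (e-rep ρq)) (cong₂ _-_ (e-rep ρr) (e-rep ρ)))
    where
    ρr  = shift-r i s ρ xi ys
    ρq  = shift-q j t ρ xj zt
    ρqr = shift-r k s ρq xk ys
    combine-levels : + (ℓ ℕ.+ (j ℕ.+ t)) - + 1 + + (k ℕ.+ s) - + 1 ≡ + (ℓ ℕ.+ (j ℕ.+ t) ℕ.+ (k ℕ.+ s)) - + 2
    combine-levels = lem (+ (ℓ ℕ.+ (j ℕ.+ t))) (+ (k ℕ.+ s))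
      where
      lem : ∀ i j → i - + 1 + j - + 1 ≡ i + j - + 2
      lem = solve-∀
  S-value {m} {l = -[1+ n ]} i j k s t ρ m<N _ _ _ _ _ with () ← level-nonneg ρ m<N

  open Rep
  open InRange

  A : Seq
  A = box p S

  A-causal : Causal A
  A-causal = box-causal p S (factors-causal (q ∷ r ∷ []) e e-causal)

  -- `box p` acts as (X^p - 1)/(X - 1), so X - 1 on the left turns it into X^p - 1; with the factors
  -- of S this leaves exactly the product treated by `e-generating`.
  A-generating : factors (q ℕ.* r ∷ p ℕ.* r ∷ p ℕ.* q ∷ 1 ∷ []) A ≋
    factors (r ∷ q ∷ p ∷ p ℕ.* q ℕ.* r ∷ []) δ below (p ℕ.* q ℕ.* r)
  A-generating m m<N = begin
    factors (q ℕ.* r ∷ p ℕ.* r ∷ p ℕ.* q ∷ 1 ∷ []) A m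
      ≡⟨ factors-cong-below (q ℕ.* r ∷ p ℕ.* r ∷ p ℕ.* q ∷ []) _ ([X^ 1 -1] A) ([X^ p -1] S) (λ m _ → box-factor p S m) m m<N ⟩
    factors (q ℕ.* r ∷ p ℕ.* r ∷ p ℕ.* q ∷ p ∷ q ∷ r ∷ []) e m
      ≡⟨ factors-↭ e reorder m ⟩
    factors (r ∷ q ∷ p ∷ q ℕ.* r ∷ p ℕ.* r ∷ p ℕ.* q ∷ []) e m
      ≡⟨ factors-cong-below (r ∷ q ∷ p ∷ []) _ (factors (q ℕ.* r ∷ p ℕ.* r ∷ p ℕ.* q ∷ []) e) ([X^ p ℕ.* q ℕ.* r -1] δ) e-generating m m<N ⟩
    factors (r ∷ q ∷ p ∷ p ℕ.* q ℕ.* r ∷ []) δ m ∎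
    where
    open ≡-Reasoning
    reorder : q ℕ.* r ∷ p ℕ.* r ∷ p ℕ.* q ∷ p ∷ q ∷ r ∷ [] ↭ r ∷ q ∷ p ∷ q ℕ.* r ∷ p ℕ.* r ∷ p ℕ.* q ∷ []
    reorder = ↭-trans (↭ₚ.++-comm (q ℕ.* r ∷ p ℕ.* r ∷ p ℕ.* q ∷ []) (p ∷ q ∷ r ∷ []))
      (↭ₚ.++⁺ʳ (q ℕ.* r ∷ p ℕ.* r ∷ p ℕ.* q ∷ []) (↭-sym (↭ₚ.↭-reverse (p ∷ q ∷ r ∷ []))))

  -- qr(x - x′) = (m - m′) + rp(y′ - y) + pq(z′ - z) is less than qr(h + h′).
  x-spread : ∀ {m x y z l m′ x′ y′ z′} h h′ → 2 ℕ.≤ p → Rep m x y z l → Rep m′ x′ y′ z′ l → m - m′ < P →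
    P * (y′ - y) ≤ Q * h - P + + 1 → P * (z′ - z) ≤ R * h′ - P + + 1 → x < x′ + (h + h′)
  x-spread {m} {x} {y} {z} {l} {m′} {x′} {y′} {z′} h h′ 2≤p ρ ρ′ m-m′<p y-width z-width =
    ℤₚ.*-cancelˡ-<-nonNeg (+ (q ℕ.* r)) (subst (λ i → i * x < i * (x′ + (h + h′))) (sym (ℤₚ.pos-* q r))
      (<-slack slack (trans (lem P Q R x y z l m x′ y′ z′ m′ h h′) (difference (equation ρ′) (equation ρ))) 0≤slack))
    where
    -- The last summand is (p - 1)(q + r - 1) - 1, what remains after the two width bounds and m -
    -- m′ ≤ p - 1; splitting off p - 2 shows that it is nonnegative.
    slack = R * ((Q * h - P + + 1) - P * (y′ - y)) + Q * ((R * h′ - P + + 1) - P * (z′ - z)) + (P - (m - m′) - + 1)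
      + ((P - + 2) * ((Q - + 1) + R) + ((Q - + 1) + (R - + 1)))
    pos-1 : ∀ n .{{_ : NonZero n}} → + 0 ≤ + n - + 1
    pos-1 n = ≤⇒0≤ (ℤ.+≤+ (ℕ.>-nonZero⁻¹ n))
    0≤slack : + 0 ≤ slack
    0≤slack = 0≤+ (0≤+ (0≤+ (0≤* (0≤pos r) (≤⇒0≤ y-width)) (0≤* (0≤pos q) (≤⇒0≤ z-width))) (<⇒0≤ m-m′<p))
      (0≤+ (0≤* (≤⇒0≤ (ℤ.+≤+ 2≤p)) (0≤+ (pos-1 q) (0≤pos r))) (0≤+ (pos-1 q) (pos-1 r)))
    lem : ∀ P Q R x y z l m x′ y′ z′ m′ h h′ →
      Q * R * (x′ + (h + h′)) - Q * R * x - + 1 ≡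
      ((x′ * (Q * R) + y′ * (R * P) + z′ * (P * Q)) - (m′ + l * (P * Q * R))) - ((x * (Q * R) + y * (R * P) + z * (P * Q)) - (m + l * (P * Q * R)))
      + (R * ((Q * h - P + + 1) - P * (y′ - y)) + Q * ((R * h′ - P + + 1) - P * (z′ - z)) + (P - (m - m′) - + 1)
        + ((P - + 2) * ((Q - + 1) + R) + ((Q - + 1) + (R - + 1))))
    lem = solve-∀

  module _ (n : ℤ) (n<N : n < N) where

    private
      X Y Z L : ℕ → ℤ
      X i = proj₁ (coordinates (n - + i))
      Y i = proj₁ (proj₂ (coordinates (n - + i)))
      Z i = proj₁ (proj₂ (proj₂ (coordinates (n - + i))))
      L i = proj₁ (proj₂ (proj₂ (proj₂ (coordinates (n - + i)))))

      ρ : ∀ i → Rep (n - + i) (X i) (Y i) (Z i) (L i)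
      ρ i = proj₂ (proj₂ (proj₂ (proj₂ (coordinates (n - + i)))))

      small : ∀ i → n - + i < N
      small i = ℤₚ.≤-<-trans (ℤₚ.i-j≤i n (+ i)) n<N

      -- Modulo p one has x qr ≡ n - i, so equal x force i ≡ j, and both indices lie in [0, p).
      X-injective : ∀ {i j} → i ℕ.< p → j ℕ.< p → X i ≡ X j → i ≡ j
      X-injective {i} {j} i<p j<p eq = sym (ℤₚ.+-injective (inRange-unique
        K (coprime-sym (1-coprimeTo p))
        (range (0≤pos j) (ℤ.+<+ j<p)) (range (0≤pos i) (ℤ.+<+ i<p)) (begin
          (+ j - + i) * + 1
            ≡⟨ lem P Q R n (+ i) (+ j) (X i) (Y i) (Z i) (L i) (X j) (Y j) (Z j) (L j) ⟩
          _                              ≡⟨ difference (equation (ρ j)) (equation (ρ i)) ⟩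
          (X i - X j) * (Q * R) + K * P  ≡⟨ cong (λ d → d * (Q * R) + K * P) (ℤₚ.i≡j⇒i-j≡0 eq) ⟩
          + 0 * (Q * R) + K * P          ≡⟨ cong (_+ K * P) (ℤₚ.*-zeroˡ (Q * R)) ⟩
          + 0 + K * P                    ≡⟨ ℤₚ.+-identityˡ (K * P) ⟩
          K * P                          ∎)))
        where
        open ≡-Reasoning
        K = (Y i - Y j) * R + (Z i - Z j) * Q - (L i - L j) * (Q * R)
        lem : ∀ P Q R n i j x y z l x′ y′ z′ l′ → (j - i) * + 1 ≡
          ((x′ * (Q * R) + y′ * (R * P) + z′ * (P * Q)) - ((n - j) + l′ * (P * Q * R))) - ((x * (Q * R) + y * (R * P) + z * (P * Q)) - ((n - i) + l * (P * Q * R)))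
          + ((x - x′) * (Q * R) + ((y - y′) * R + (z - z′) * Q - (l - l′) * (Q * R)) * P)
        lem = solve-∀

      open Counting p X (λ i → nonneg (x-range (ρ i))) X-injective

      window : ∀ {i j} → i ℕ.< p → j ℕ.< p → (n - + i) - (n - + j) < P
      window {i} {j} i<p j<p = <-slack _ (lem P n (+ i) (+ j)) (0≤+ (<⇒0≤ (ℤ.+<+ j<p)) (0≤pos i))
        where
        lem : ∀ p n i j → p - ((n - i) - (n - j)) - + 1 ≡ (p - j - + 1) + i
        lem = solve-∀

      interval : ∀ {B : ℕ → Set} lo hi L → hi ≤ lo + + L → (∀ {i} → B i → lo ≤ X i) → (∀ {i} → B i → X i < hi) → Spread B L
      interval lo hi L hi≤ lower upper _ _ bi bj =
        ℤₚ.<-≤-trans (upper bi) (ℤₚ.≤-trans hi≤ (ℤₚ.+-monoˡ-≤ (+ L) (lower bj)))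

      upper-count : ∀ {B C : ℕ → Set} {L M} → (∀ i → AtMost (S (n - + i)) (B i ⊎ C i)) →
        Spread B L → Spread C M → A n ≤ + (L ℕ.+ M)
      upper-count = box-count S n

      lower-count : ∀ {B C : ℕ → Set} {L M} → (∀ i → AtLeast (S (n - + i)) (B i ⊎ C i)) →
        Spread B L → Spread C M → - A n ≤ + (L ℕ.+ M)
      lower-count class B-spread C-spread = subst (_≤ _) (box-neg p S n)
        (box-count (λ m → - S m) n (AtLeast⇒AtMost ∘ class) B-spread C-spread)

    -- The case α = q′, β = r′. The thresholds q′ ≤ r′ ≤ q′ + r′ cut [0, p) into four pieces, on
    -- which S is ≥ 0, ≤ 0, ≤ 0, ≥ 0 in turn. The first and the third have length α.
    module _ (q′≤r′ : q′ ℕ.≤ r′) (q′+r′≤p : q′ ℕ.+ r′ ℕ.≤ p) where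

      private
        Upper Lower : (x y z l : ℤ) → Set
        Upper x y z l = x < + q′ ⊎ (+ (q′ ℕ.+ r′) ≤ x × l ≡ + 2 × + b ≤ y × + c ≤ z)
        Lower x y z l = (+ r′ ≤ x × x < + (q′ ℕ.+ r′)) ⊎ (+ q′ ≤ x × x < + r′ × l ≡ + 1 × + b ≤ y × z < + c)

        classify : ∀ {m x y z l} → Rep m x y z l → m < N → AtMost (S m) (Upper x y z l) × AtLeast (S m) (Lower x y z l)
        classify {x = x} ρ m<N with wrap? b≤q (y-range ρ) | wrap? c≤r (z-range ρ)
        ... | s , ys , s0 , s1 | t , zt , t0 , t1 with x ℤₚ.<? + q′
        ... | yes x<q′ =
          let x<r′ = ℤₚ.<-≤-trans x<q′ (ℤ.+≤+ q′≤r′)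
              xj   = wrapped r′≤p (x-range ρ) x<r′
              ℓ , l≡ , adm , S≡ = S-value 1 1 0 (toℕ s) (toℕ t) ρ m<N (wrapped q′≤p (x-range ρ) x<q′) xj
                (unwrapped q′ xj (≤-slack _ (lem x P (+ q′) (+ r′)) (0≤+ (nonneg (x-range ρ)) (≤⇒0≤ (ℤ.+≤+ q′+r′≤p))))) ys zt
          in positive-verdict S≡ (σ-110 s t ℓ adm) (λ _ → inj₁ x<q′)
          where
          lem : ∀ x p q′ r′ → (x - r′ + + 1 * p) - q′ ≡ x + (p - (q′ + r′))
          lem = solve-∀
        ... | no x≮q′ with x ℤₚ.<? + r′
        ... | yes x<r′ =
          let q′≤x = ℤₚ.≮⇒≥ x≮q′
              xj   = wrapped r′≤p (x-range ρ) x<r′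
              ℓ , l≡ , adm , S≡ = S-value 0 1 0 (toℕ s) (toℕ t) ρ m<N (unwrapped q′ (x-range ρ) q′≤x) xj
                (unwrapped q′ xj (≤-slack _ (lem x P (+ q′) (+ r′)) (0≤+ (≤⇒0≤ q′≤x) (≤⇒0≤ (ℤ.+≤+ r′≤p))))) ys zt
          in negative-verdict S≡ (σ-010 s t ℓ adm) (λ (ℓ≡1 , s≡0 , t≡1) → inj₂ (q′≤x , x<r′ , trans l≡ (cong +_ ℓ≡1) , s0 s≡0 , t1 t≡1))
          where
          lem : ∀ x p q′ r′ → (x - r′ + + 1 * p) - q′ ≡ (x - q′) + (p - r′)
          lem = solve-∀
        ... | no x≮r′ with x ℤₚ.<? + (q′ ℕ.+ r′)
        ... | yes x<q′+r′ =
          let r′≤x = ℤₚ.≮⇒≥ x≮r′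
              xj   = unwrapped r′ (x-range ρ) r′≤x
              ℓ , l≡ , adm , S≡ = S-value 0 0 1 (toℕ s) (toℕ t) ρ m<N (unwrapped q′ (x-range ρ) (ℤₚ.≮⇒≥ x≮q′)) xj
                (wrapped q′≤p xj (<-slack _ (lem x P (+ q′) (+ r′)) (<⇒0≤ x<q′+r′))) ys zt
          in negative-verdict S≡ (σ-001 s t ℓ adm) (λ _ → inj₁ (r′≤x , x<q′+r′))
          where
          lem : ∀ x p q′ r′ → q′ - (x - r′ + + 0 * p) - + 1 ≡ (q′ + r′) - x - + 1
          lem = solve-∀
        ... | no x≮q′+r′ =
          let q′+r′≤x = ℤₚ.≮⇒≥ x≮q′+r′
              xj   = unwrapped r′ (x-range ρ) (ℤₚ.≮⇒≥ x≮r′)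
              ℓ , l≡ , adm , S≡ = S-value 0 0 0 (toℕ s) (toℕ t) ρ m<N (unwrapped q′ (x-range ρ) (ℤₚ.≮⇒≥ x≮q′)) xj
                (unwrapped q′ xj (≤-slack _ (lem x P (+ q′) (+ r′)) (≤⇒0≤ q′+r′≤x))) ys zt
          in positive-verdict S≡ (σ-000 s t ℓ adm) (λ (ℓ≡2 , s≡0 , t≡0) → inj₂ (q′+r′≤x , trans l≡ (cong +_ ℓ≡2) , s0 s≡0 , t0 t≡0))
          where
          lem : ∀ x p q′ r′ → (x - r′ + + 0 * p) - q′ ≡ x - (q′ + r′)
          lem = solve-∀

        upper : ∀ i → AtMost (S (n - + i)) (Upper (X i) (Y i) (Z i) (L i))
        upper i = proj₁ (classify (ρ i) (small i))

        lower : ∀ i → AtLeast (S (n - + i)) (Lower (X i) (Y i) (Z i) (L i))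
        lower i = proj₂ (classify (ρ i) (small i))

        upper-interval : Spread (λ i → X i < + q′) q′
        upper-interval = interval (+ 0) (+ q′) q′ ℤₚ.≤-refl (λ {i} _ → nonneg (x-range (ρ i))) (λ x<q′ → x<q′)

        lower-interval : Spread (λ i → + r′ ≤ X i × X i < + (q′ ℕ.+ r′)) q′
        lower-interval = interval (+ r′) (+ (q′ ℕ.+ r′)) q′ (ℤₚ.≤-reflexive (ℤₚ.+-comm (+ q′) (+ r′))) proj₁ proj₂

      -- The piece x < q′ contributes at most α. On the other one the level is 2 with b ≤ y and c ≤
      -- z, so `x-spread` applies with h = q′ and h′ = r′ and allows α + β more.
      upper₁ : 2 ℕ.≤ p → A n ≤ + (q′ ℕ.+ (q′ ℕ.+ r′))
      upper₁ 2≤p = upper-count upper upper-interval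
        λ { {i} {j} i<p j<p (_ , li , yi , zi) (_ , lj , _ , _) → x-spread (+ q′) (+ r′) 2≤p
          (ρ i) (subst (Rep _ _ _ _) (trans lj (sym li)) (ρ j)) (window i<p j<p)
          (width-above p q q′ b q-inverse (y-range (ρ i)) (y-range (ρ j)) yi)
          (width-above p r r′ c r-inverse (z-range (ρ i)) (z-range (ρ j)) zi) }

      upper₁′ : A n ≤ + (q′ ℕ.+ (p ℕ.∸ (q′ ℕ.+ r′)))
      upper₁′ = upper-count upper upper-interval
        (interval (+ (q′ ℕ.+ r′)) P _ (ℤ.+≤+ (ℕₚ.≤-reflexive (sym (ℕₚ.m+[n∸m]≡n q′+r′≤p)))) proj₁ (λ {i} _ → bounded (x-range (ρ i))))

      -- In contrast to `upper₁` z now lies below c, which replaces r′ by p - r′ and hence β by p -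
      -- β.
      lower₁ : 2 ℕ.≤ p → - A n ≤ + (q′ ℕ.+ (q′ ℕ.+ (p ℕ.∸ r′)))
      lower₁ 2≤p = lower-count lower lower-interval
        λ { {i} {j} i<p j<p (_ , _ , li , yi , _) (_ , _ , lj , _ , zj) → subst (λ h → X i < X j + (+ q′ + h)) (sym (pos-∸ r′≤p))
          (x-spread (+ q′) (P - + r′) 2≤p
          (ρ i) (subst (Rep _ _ _ _) (trans lj (sym li)) (ρ j)) (window i<p j<p)
          (width-above p q q′ b q-inverse (y-range (ρ i)) (y-range (ρ j)) yi)
          (width-below p r r′ c r-inverse (z-range (ρ i)) (z-range (ρ j)) zj)) }

      lower₁′ : - A n ≤ + (q′ ℕ.+ (r′ ℕ.∸ q′))
      lower₁′ = lower-count lower lower-interval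
        (interval (+ q′) (+ r′) _ (ℤ.+≤+ (ℕₚ.≤-reflexive (sym (ℕₚ.m+[n∸m]≡n q′≤r′)))) proj₁ (proj₁ ∘ proj₂))

    -- The mirrored case α = p - q′, β = p - r′. The thresholds are now q′ + r′ - p ≤ r′ ≤ q′, with
    -- S ≥ 0 on the first two pieces and S ≤ 0 on the last two. The lowest one is tested on x + p to
    -- avoid a subtraction.
    module _ (r′≤q′ : r′ ℕ.≤ q′) (p≤q′+r′ : p ℕ.≤ q′ ℕ.+ r′) where

      private
        Upper Lower : (x y z l : ℤ) → Set
        Upper x y z l = (+ (q′ ℕ.+ r′) ≤ x + P × x < + r′) ⊎ (x + P < + (q′ ℕ.+ r′) × l ≡ + 0 × y < + b × z < + c)
        Lower x y z l = + q′ ≤ x ⊎ (+ r′ ≤ x × x < + q′ × l ≡ + 1 × y < + b × + c ≤ z)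

        classify : ∀ {m x y z l} → Rep m x y z l → m < N → AtMost (S m) (Upper x y z l) × AtLeast (S m) (Lower x y z l)
        classify {x = x} ρ m<N with wrap? b≤q (y-range ρ) | wrap? c≤r (z-range ρ)
        ... | s , ys , s0 , s1 | t , zt , t0 , t1 with x ℤₚ.<? + r′
        ... | yes x<r′ with x + P ℤₚ.<? + (q′ ℕ.+ r′)
        ... | yes x+p<q′+r′ =
          let xj   = wrapped r′≤p (x-range ρ) x<r′
              ℓ , l≡ , adm , S≡ = S-value 1 1 1 (toℕ s) (toℕ t) ρ m<N (wrapped q′≤p (x-range ρ) (ℤₚ.<-≤-trans x<r′ (ℤ.+≤+ r′≤q′))) xj
                (wrapped q′≤p xj (<-slack _ (lem x P (+ q′) (+ r′)) (<⇒0≤ x+p<q′+r′))) ys zt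
          in positive-verdict S≡ (σ-111 s t ℓ adm) (λ (ℓ≡0 , s≡1 , t≡1) → inj₂ (x+p<q′+r′ , trans l≡ (cong +_ ℓ≡0) , s1 s≡1 , t1 t≡1))
          where
          lem : ∀ x p q′ r′ → q′ - (x - r′ + + 1 * p) - + 1 ≡ (q′ + r′) - (x + p) - + 1
          lem = solve-∀
        ... | no x+p≮q′+r′ =
          let xj   = wrapped r′≤p (x-range ρ) x<r′
              ℓ , l≡ , adm , S≡ = S-value 1 1 0 (toℕ s) (toℕ t) ρ m<N (wrapped q′≤p (x-range ρ) (ℤₚ.<-≤-trans x<r′ (ℤ.+≤+ r′≤q′))) xj
                (unwrapped q′ xj (≤-slack _ (lem x P (+ q′) (+ r′)) (≤⇒0≤ (ℤₚ.≮⇒≥ x+p≮q′+r′)))) ys zt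
          in positive-verdict S≡ (σ-110 s t ℓ adm) (λ _ → inj₁ (ℤₚ.≮⇒≥ x+p≮q′+r′ , x<r′))
          where
          lem : ∀ x p q′ r′ → (x - r′ + + 1 * p) - q′ ≡ (x + p) - (q′ + r′)
          lem = solve-∀
        classify {x = x} ρ m<N | s , ys , s0 , s1 | t , zt , t0 , t1 | no x≮r′ with x ℤₚ.<? + q′
        ... | yes x<q′ =
          let r′≤x = ℤₚ.≮⇒≥ x≮r′
              xj   = unwrapped r′ (x-range ρ) r′≤x
              ℓ , l≡ , adm , S≡ = S-value 1 0 1 (toℕ s) (toℕ t) ρ m<N (wrapped q′≤p (x-range ρ) x<q′) xj
                (wrapped q′≤p xj (<-slack _ (lem x P (+ q′) (+ r′)) (0≤+ (<⇒0≤ x<q′) (0≤pos r′)))) ys zt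
          in negative-verdict S≡ (σ-101 s t ℓ adm) (λ (ℓ≡1 , s≡1 , t≡0) → inj₂ (r′≤x , x<q′ , trans l≡ (cong +_ ℓ≡1) , s1 s≡1 , t0 t≡0))
          where
          lem : ∀ x p q′ r′ → q′ - (x - r′ + + 0 * p) - + 1 ≡ (q′ - x - + 1) + r′
          lem = solve-∀
        ... | no x≮q′ =
          let q′≤x = ℤₚ.≮⇒≥ x≮q′
              xj   = unwrapped r′ (x-range ρ) (ℤₚ.≮⇒≥ x≮r′)
              ℓ , l≡ , adm , S≡ = S-value 0 0 1 (toℕ s) (toℕ t) ρ m<N (unwrapped q′ (x-range ρ) q′≤x) xj
                (wrapped q′≤p xj (<-slack _ (lem x P (+ q′) (+ r′)) (0≤+ (<⇒0≤ (bounded (x-range ρ))) (≤⇒0≤ (ℤ.+≤+ p≤q′+r′))))) ys zt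
          in negative-verdict S≡ (σ-001 s t ℓ adm) (λ _ → inj₁ q′≤x)
          where
          lem : ∀ x p q′ r′ → q′ - (x - r′ + + 0 * p) - + 1 ≡ (p - x - + 1) + ((q′ + r′) - p)
          lem = solve-∀

        upper : ∀ i → AtMost (S (n - + i)) (Upper (X i) (Y i) (Z i) (L i))
        upper i = proj₁ (classify (ρ i) (small i))

        lower : ∀ i → AtLeast (S (n - + i)) (Lower (X i) (Y i) (Z i) (L i))
        lower i = proj₂ (classify (ρ i) (small i))

        upper-interval : Spread (λ i → + (q′ ℕ.+ r′) ≤ X i + P × X i < + r′) (p ℕ.∸ q′)
        upper-interval = interval (+ (q′ ℕ.+ r′) - P) (+ r′) (p ℕ.∸ q′)
          (ℤₚ.≤-reflexive (trans (lem (+ q′) (+ r′) P) (cong (λ i → + (q′ ℕ.+ r′) - P + i) (sym (pos-∸ q′≤p)))))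
          (λ {i} (le , _) → ≤-slack _ (lem′ (X i) (+ (q′ ℕ.+ r′)) P) (≤⇒0≤ le)) proj₂
          where
          lem : ∀ q′ r′ p → r′ ≡ (q′ + r′) - p + (p - q′)
          lem = solve-∀
          lem′ : ∀ x i p → x - (i - p) ≡ (x + p) - i
          lem′ = solve-∀

        lower-interval : Spread (λ i → + q′ ≤ X i) (p ℕ.∸ q′)
        lower-interval = interval (+ q′) P (p ℕ.∸ q′) (ℤ.+≤+ (ℕₚ.≤-reflexive (sym (ℕₚ.m+[n∸m]≡n q′≤p))))
          (λ q′≤x → q′≤x) (λ {i} _ → bounded (x-range (ρ i)))

      -- Here y < b and z < c at level 0, so both widths are of the lower kind and h + h′ = (p - q′)
      -- + (p - r′) = α + β.
      upper₂ : 2 ℕ.≤ p → A n ≤ + ((p ℕ.∸ q′) ℕ.+ ((p ℕ.∸ q′) ℕ.+ (p ℕ.∸ r′)))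
      upper₂ 2≤p = upper-count upper upper-interval
        λ { {i} {j} i<p j<p (_ , li , _ , _) (_ , lj , yj , zj) → subst (λ h → X i < X j + h) (sym (cong₂ _+_ (pos-∸ q′≤p) (pos-∸ r′≤p)))
          (x-spread (P - + q′) (P - + r′) 2≤p
          (ρ i) (subst (Rep _ _ _ _) (trans lj (sym li)) (ρ j)) (window i<p j<p)
          (width-below p q q′ b q-inverse (y-range (ρ i)) (y-range (ρ j)) yj)
          (width-below p r r′ c r-inverse (z-range (ρ i)) (z-range (ρ j)) zj)) }

      upper₂′ : A n ≤ + ((p ℕ.∸ q′) ℕ.+ ((q′ ℕ.+ r′) ℕ.∸ p))
      upper₂′ = upper-count upper upper-interval
        (interval (+ 0) (+ ((q′ ℕ.+ r′) ℕ.∸ p)) _ ℤₚ.≤-refl (λ {i} _ → nonneg (x-range (ρ i)))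
          λ {i} (lt , _) → subst (X i <_) (sym (pos-∸ p≤q′+r′)) (<-slack _ (lem (X i) (+ (q′ ℕ.+ r′)) P) (<⇒0≤ lt)))
        where
        lem : ∀ x i p → i - p - x - + 1 ≡ i - (x + p) - + 1
        lem = solve-∀

      lower₂ : 2 ℕ.≤ p → - A n ≤ + ((p ℕ.∸ q′) ℕ.+ ((p ℕ.∸ q′) ℕ.+ r′))
      lower₂ 2≤p = lower-count lower lower-interval
        λ { {i} {j} i<p j<p (_ , _ , li , _ , zi) (_ , _ , lj , yj , _) → subst (λ h → X i < X j + (h + + r′)) (sym (pos-∸ q′≤p))
          (x-spread (P - + q′) (+ r′) 2≤p
          (ρ i) (subst (Rep _ _ _ _) (trans lj (sym li)) (ρ j)) (window i<p j<p)
          (width-below p q q′ b q-inverse (y-range (ρ i)) (y-range (ρ j)) yj)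
          (width-above p r r′ c r-inverse (z-range (ρ i)) (z-range (ρ j)) zi)) }

      lower₂′ : - A n ≤ + ((p ℕ.∸ q′) ℕ.+ (q′ ℕ.∸ r′))
      lower₂′ = lower-count lower lower-interval
        (interval (+ r′) (+ q′) _ (ℤ.+≤+ (ℕₚ.≤-reflexive (sym (ℕₚ.m+[n∸m]≡n r′≤q′)))) proj₁ (proj₁ ∘ proj₂))

-- Congruences relating α, β and the inverses

mod-quotient : ∀ x p → x ≡ 1 [mod p ] → ∃[ k ] + x ℤ.- + 1 ≡ k ℤ.* + p
mod-quotient x p x≡1 with Signed.∣ᵤ⇒∣ {+ p} {+ x ℤ.- + 1} x≡1
... | Signed.divides k eq = k , eq

-- If q q′ = 1 + k p, then q - k serves as b; it lies between 0 and q because 1 ≤ q q′ ≤ q p.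
complementary-inverse : ∀ {p q q′} → IsInverseMod p q q′ → 0 ℕ.< q →
  ∃[ b ] b ℕ.≤ q × + q′ ℤ.* + q ℤ.+ + b ℤ.* + p ≡ + 1 ℤ.+ + p ℤ.* + q
complementary-inverse {p} {q} {q′} inv 0<q with mod-quotient (q ℕ.* q′) p (IsInverseMod.inverse inv)
... | k , eq = ℤ.∣ + q ℤ.- k ∣ , b≤q , (begin
    + q′ ℤ.* + q ℤ.+ + ℤ.∣ + q ℤ.- k ∣ ℤ.* + p   ≡⟨ cong (λ b → + q′ ℤ.* + q ℤ.+ b ℤ.* + p) (ℤₚ.0≤i⇒+∣i∣≡i 0≤q-k) ⟩
    + q′ ℤ.* + q ℤ.+ (+ q ℤ.- k) ℤ.* + p         ≡⟨ lem (+ q′) (+ q) k (+ p) ⟩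
    (+ q ℤ.* + q′ ℤ.- + 1) ℤ.- k ℤ.* + p ℤ.+ (+ 1 ℤ.+ + p ℤ.* + q) ≡⟨ cong (ℤ._+ (+ 1 ℤ.+ + p ℤ.* + q)) (ℤₚ.i≡j⇒i-j≡0 eq′) ⟩
    + 0 ℤ.+ (+ 1 ℤ.+ + p ℤ.* + q)                ≡⟨ ℤₚ.+-identityˡ _ ⟩
    + 1 ℤ.+ + p ℤ.* + q                          ∎)
  where
  open ≡-Reasoning
  open IsInverseMod inv
  eq′ : + q ℤ.* + q′ ℤ.- + 1 ≡ k ℤ.* + p
  eq′ = trans (cong (ℤ._- + 1) (sym (ℤₚ.pos-* q q′))) eq
  lem : ∀ q′ q k p → q′ ℤ.* q ℤ.+ (q ℤ.- k) ℤ.* p ≡ (q ℤ.* q′ ℤ.- + 1) ℤ.- k ℤ.* p ℤ.+ (+ 1 ℤ.+ p ℤ.* q)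
  lem = solve-∀
  0<p : 0 ℕ.< p
  0<p = ℕₚ.<-trans positive below
  instance
    p≢0 : ℕ.NonZero p
    p≢0 = ℕ.>-nonZero 0<p
  0≤k : + 0 ℤ.≤ k
  0≤k = ℤₚ.*-cancelʳ-≤-pos (+ 0) k (+ p) {{ℤ.positive (ℤ.+<+ 0<p)}} (subst (+ 0 ℤ.≤_) eq
    (≤⇒0≤ (ℤ.+≤+ (ℕₚ.*-mono-< 0<q positive))))
  0≤q-k : + 0 ℤ.≤ + q ℤ.- k
  0≤q-k = ≤⇒0≤ (ℤₚ.*-cancelʳ-≤-pos k (+ q) (+ p) {{ℤ.positive (ℤ.+<+ 0<p)}} (subst (ℤ._≤ + q ℤ.* + p) eq
    (ℤₚ.≤-trans (ℤₚ.i-j≤i (+ (q ℕ.* q′)) (+ 1)) (subst (+ (q ℕ.* q′) ℤ.≤_) (ℤₚ.pos-* q p) (ℤ.+≤+ (ℕₚ.*-monoʳ-≤ q (ℕₚ.<⇒≤ below)))))))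
  b≤q : ℤ.∣ + q ℤ.- k ∣ ℕ.≤ q
  b≤q = ℤₚ.drop‿+≤+ (subst (ℤ._≤ + q) (sym (ℤₚ.0≤i⇒+∣i∣≡i 0≤q-k)) (≤-slack k (lem′ (+ q) k) 0≤k))
    where
    lem′ : ∀ q k → q ℤ.- (q ℤ.- k) ≡ k
    lem′ = solve-∀

module _ {p q r q′ r′ α β : ℕ} (pr : Coprime p r) (q-inv : IsInverseMod p q q′) (r-inv : IsInverseMod p r r′)
  (β<p : β ℕ.< p) (αβ : α ℕ.* β ℕ.* q ℕ.* r ≡ 1 [mod p ]) where

  private
    open IsInverseMod
    quotient-αβ = mod-quotient (α ℕ.* β ℕ.* q ℕ.* r) p αβ
    quotient-q  = mod-quotient (q ℕ.* q′) p (inverse q-inv)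
    quotient-r  = mod-quotient (r ℕ.* r′) p (inverse r-inv)

    k₁ = proj₁ quotient-αβ
    k₂ = proj₁ quotient-q
    k₃ = proj₁ quotient-r

    E₁ : + α ℤ.* + β ℤ.* + q ℤ.* + r ℤ.- + 1 ≡ k₁ ℤ.* + p
    E₁ = trans (cong (ℤ._- + 1) (sym (trans (ℤₚ.pos-* (α ℕ.* β ℕ.* q) r) (cong (ℤ._* + r)
      (trans (ℤₚ.pos-* (α ℕ.* β) q) (cong (ℤ._* + q) (ℤₚ.pos-* α β))))))) (proj₂ quotient-αβ)

    E₂ : + q ℤ.* + q′ ℤ.- + 1 ≡ k₂ ℤ.* + p
    E₂ = trans (cong (ℤ._- + 1) (sym (ℤₚ.pos-* q q′))) (proj₂ quotient-q)

    E₃ : + r ℤ.* + r′ ℤ.- + 1 ≡ k₃ ℤ.* + p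
    E₃ = trans (cong (ℤ._- + 1) (sym (ℤₚ.pos-* r r′))) (proj₂ quotient-r)

  -- Cancelling q q′ ≡ 1 from αβqr ≡ 1 leaves β r ≡ 1, which has one solution in range.
  second-inverse : α ≡ q′ → β ≡ r′
  second-inverse refl = ℤₚ.+-injective (inRange-unique (k₁ ℤ.- + β ℤ.* + r ℤ.* k₂ ℤ.- k₃) pr
    (range (0≤pos β) (ℤ.+<+ β<p)) (range (0≤pos r′) (ℤ.+<+ (below r-inv)))
    (trans (lem₁ (+ q′) (+ q) (+ r) (+ r′) (+ β)) (trans
      (cong₂ ℤ._-_ (cong₂ ℤ._-_ E₁ (cong (+ β ℤ.* + r ℤ.*_) E₂)) E₃)
      (lem₂ k₁ k₂ k₃ (+ β ℤ.* + r) (+ p)))))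
    where
    lem₁ : ∀ q′ q r r′ β → (β ℤ.- r′) ℤ.* r ≡
      (q′ ℤ.* β ℤ.* q ℤ.* r ℤ.- + 1) ℤ.- β ℤ.* r ℤ.* (q ℤ.* q′ ℤ.- + 1) ℤ.- (r ℤ.* r′ ℤ.- + 1)
    lem₁ = solve-∀
    lem₂ : ∀ k₁ k₂ k₃ i p → k₁ ℤ.* p ℤ.- i ℤ.* (k₂ ℤ.* p) ℤ.- k₃ ℤ.* p ≡ (k₁ ℤ.- i ℤ.* k₂ ℤ.- k₃) ℤ.* p
    lem₂ = solve-∀

  -- Now α q ≡ -1, so β r ≡ -1 and β ≡ -r′ modulo p.
  second-inverse-complement : α ≡ p ℕ.∸ q′ → β ≡ p ℕ.∸ r′
  second-inverse-complement α≡ = ℤₚ.+-injective (inRange-unique (ℤ.- k₁ ℤ.+ + β ℤ.* + q ℤ.* + r ℤ.- + β ℤ.* + r ℤ.* k₂ ℤ.+ k₃ ℤ.- + r) pr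
    (range (0≤pos β) (ℤ.+<+ β<p))
    (range (0≤pos _) (ℤ.+<+ (ℕₚ.∸-monoʳ-< (positive r-inv) (ℕₚ.<⇒≤ (below r-inv)))))
    (trans (cong (λ i → (+ β ℤ.- i) ℤ.* + r) (pos-∸ (ℕₚ.<⇒≤ (below r-inv))))
    (trans (lem₁ (+ p) (+ q′) (+ q) (+ r) (+ r′) (+ β))
    (trans (cong (λ i → ℤ.- (i ℤ.* + β ℤ.* + q ℤ.* + r ℤ.- + 1) ℤ.+ + β ℤ.* + q ℤ.* + r ℤ.* + p ℤ.- + β ℤ.* + r ℤ.* (+ q ℤ.* + q′ ℤ.- + 1) ℤ.+ (+ r ℤ.* + r′ ℤ.- + 1) ℤ.- + r ℤ.* + p)
             (sym (trans (cong +_ α≡) (pos-∸ (ℕₚ.<⇒≤ (below q-inv))))))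
    (trans (cong (ℤ._- + r ℤ.* + p) (cong₂ ℤ._+_ (cong₂ ℤ._-_ (cong (λ i → ℤ.- i ℤ.+ + β ℤ.* + q ℤ.* + r ℤ.* + p) E₁) (cong (+ β ℤ.* + r ℤ.*_) E₂)) E₃))
           (lem₂ k₁ k₂ k₃ (+ β ℤ.* + r) (+ β ℤ.* + q ℤ.* + r) (+ r) (+ p)))))))
    where
    lem₁ : ∀ p q′ q r r′ β → (β ℤ.- (p ℤ.- r′)) ℤ.* r ≡
      ℤ.- ((p ℤ.- q′) ℤ.* β ℤ.* q ℤ.* r ℤ.- + 1) ℤ.+ β ℤ.* q ℤ.* r ℤ.* p ℤ.- β ℤ.* r ℤ.* (q ℤ.* q′ ℤ.- + 1) ℤ.+ (r ℤ.* r′ ℤ.- + 1) ℤ.- r ℤ.* p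
    lem₁ = solve-∀
    lem₂ : ∀ k₁ k₂ k₃ i j r p → ℤ.- (k₁ ℤ.* p) ℤ.+ j ℤ.* p ℤ.- i ℤ.* (k₂ ℤ.* p) ℤ.+ k₃ ℤ.* p ℤ.- r ℤ.* p ≡
      (ℤ.- k₁ ℤ.+ j ℤ.- i ℤ.* k₂ ℤ.+ k₃ ℤ.- r) ℤ.* p
    lem₂ = solve-∀

-- From the window sums to the coefficients and their extrema

record WithinBounds (p α β : ℕ) (v : ℤ) : Set where
  field
    upper  : v ℤ.≤ + (2 ℕ.* α ℕ.+ β)
    upper′ : v ℤ.≤ + p ℤ.- + β
    lower  : ℤ.- v ℤ.≤ + p ℤ.+ + (2 ℕ.* α) ℤ.- + β
    lower′ : ℤ.- v ℤ.≤ + β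

0-withinBounds : ∀ {p α β} → β ℕ.≤ p → WithinBounds p α β (+ 0)
0-withinBounds {p} {α} {β} β≤p = record
  { upper  = 0≤pos _
  ; upper′ = ≤⇒0≤ (ℤ.+≤+ β≤p)
  ; lower  = ≤⇒0≤ (ℤ.+≤+ (ℕₚ.≤-trans β≤p (ℕₚ.m≤m+n p (2 ℕ.* α))))
  ; lower′ = 0≤pos _
  }

module _ {c ℓ₁ ℓ₂} (K : HeytingField c ℓ₁ ℓ₂) (char0 : CharacteristicZero K)
  {p q r : ℕ} (p-prime : Prime p) (q-prime : Prime q) (r-prime : Prime r)
  (p≢q : p ≢ q) (p≢r : p ≢ r) (q≢r : q ≢ r)
  (ζ : HeytingField.Carrier K) (isPrimitive : IsPrimitiveRoot K (p ℕ.* q ℕ.* r) ζ)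
  (a : ℕ → ℤ) (a-coefficients : HasIntegerCoefficients K (Φ K (p ℕ.* q ℕ.* r) ζ) a)
  {q′ r′ : ℕ} (q-inv : IsInverseMod p q q′) (r-inv : IsInverseMod p r r′)
  {α β : ℕ} (β<p : β ℕ.< p) (αβ : α ℕ.* β ℕ.* q ℕ.* r ≡ 1 [mod p ])
  (α≤r′ : α ℕ.≤ r′) (α≤p-r′ : α ℕ.≤ p ℕ.∸ r′) where

  private
    open IsInverseMod
    instance
      p≢0 : NonZero p
      p≢0 = prime⇒nonZero p-prime
      q≢0 : NonZero q
      q≢0 = prime⇒nonZero q-prime
      r≢0 : NonZero r
      r≢0 = prime⇒nonZero r-prime

    pq = distinct-primes-coprime p-prime q-prime p≢q
    pr = distinct-primes-coprime p-prime r-prime p≢r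
    qr = distinct-primes-coprime q-prime r-prime q≢r

    q-complement = complementary-inverse q-inv (ℕ.>-nonZero⁻¹ q)
    r-complement = complementary-inverse r-inv (ℕ.>-nonZero⁻¹ r)

    q′≤p = ℕₚ.<⇒≤ (below q-inv)
    r′≤p = ℕₚ.<⇒≤ (below r-inv)

    2≤p : 2 ℕ.≤ p
    2≤p = ℕ.nonTrivial⇒n>1 p {{prime⇒nonTrivial p-prime}}

    open Bounds p q r pq pr qr q′ r′ (proj₁ q-complement) (proj₁ r-complement) q′≤p r′≤p
      (proj₁ (proj₂ q-complement)) (proj₁ (proj₂ r-complement)) (proj₂ (proj₂ q-complement)) (proj₂ (proj₂ r-complement))
    open Lattice p q r pq pr qr using (N; N≡)
    open Field K char0

    ≤-cong : ∀ {v i j} → i ≡ j → v ℤ.≤ i → v ℤ.≤ j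
    ≤-cong refl v≤i = v≤i

    -- Minimality of α turns into the order of the thresholds: α ≤ r′ is q′ ≤ r′, and α ≤ p - r′ is
    -- q′ + r′ ≤ p.
    near : α ≡ q′ → ∀ n → n ℤ.< N → WithinBounds p α β (A n)
    near α≡q′ n n<N = subst₂ (λ α β → WithinBounds p α β (A n)) (sym α≡q′) (sym (second-inverse pr q-inv r-inv β<p αβ α≡q′)) (record
      { upper  = ≤-cong (lem₁ (+ q′) (+ r′)) (upper₁ n n<N q′≤r′ q′+r′≤p 2≤p)
      ; upper′ = ≤-cong (trans (cong (λ i → + q′ ℤ.+ i) (pos-∸ q′+r′≤p)) (lem₂ (+ q′) (+ r′) (+ p))) (upper₁′ n n<N q′≤r′ q′+r′≤p)
      ; lower  = ≤-cong (trans (cong (λ i → + q′ ℤ.+ (+ q′ ℤ.+ i)) (pos-∸ r′≤p)) (lem₃ (+ q′) (+ r′) (+ p))) (lower₁ n n<N q′≤r′ q′+r′≤p 2≤p)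
      ; lower′ = ≤-cong (cong +_ (ℕₚ.m+[n∸m]≡n q′≤r′)) (lower₁′ n n<N q′≤r′ q′+r′≤p)
      })
      where
      q′≤r′ : q′ ℕ.≤ r′
      q′≤r′ = subst (ℕ._≤ r′) α≡q′ α≤r′
      q′+r′≤p : q′ ℕ.+ r′ ℕ.≤ p
      q′+r′≤p = ℕₚ.≤-trans (ℕₚ.+-monoˡ-≤ r′ (subst (ℕ._≤ p ℕ.∸ r′) α≡q′ α≤p-r′)) (ℕₚ.≤-reflexive (ℕₚ.m∸n+n≡m r′≤p))
      lem₁ : ∀ q′ r′ → q′ ℤ.+ (q′ ℤ.+ r′) ≡ (q′ ℤ.+ (q′ ℤ.+ + 0)) ℤ.+ r′
      lem₁ = solve-∀
      lem₂ : ∀ q′ r′ p → q′ ℤ.+ (p ℤ.- (q′ ℤ.+ r′)) ≡ p ℤ.- r′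
      lem₂ = solve-∀
      lem₃ : ∀ q′ r′ p → q′ ℤ.+ (q′ ℤ.+ (p ℤ.- r′)) ≡ p ℤ.+ (q′ ℤ.+ (q′ ℤ.+ + 0)) ℤ.- r′
      lem₃ = solve-∀

    -- The same two inequalities now read p ≤ q′ + r′ and r′ ≤ q′.
    far : α ≡ p ℕ.∸ q′ → ∀ n → n ℤ.< N → WithinBounds p α β (A n)
    far α≡p-q′ n n<N = subst₂ (λ α β → WithinBounds p α β (A n)) (sym α≡p-q′) (sym (second-inverse-complement pr q-inv r-inv β<p αβ α≡p-q′)) (record
      { upper  = ≤-cong (lem₁ (+ (p ℕ.∸ q′)) (+ (p ℕ.∸ r′))) (upper₂ n n<N r′≤q′ p≤q′+r′ 2≤p)
      ; upper′ = ≤-cong (trans (cong₂ ℤ._+_ (pos-∸ q′≤p) (pos-∸ p≤q′+r′)) (trans (lem₂ (+ q′) (+ r′) (+ p)) (cong (λ i → + p ℤ.- i) (sym (pos-∸ r′≤p)))))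
                   (upper₂′ n n<N r′≤q′ p≤q′+r′)
      ; lower  = ≤-cong (trans (lem₃ (+ (p ℕ.∸ q′)) (+ r′) (+ p)) (cong (λ i → + p ℤ.+ + (2 ℕ.* (p ℕ.∸ q′)) ℤ.- i) (sym (pos-∸ r′≤p))))
                   (lower₂ n n<N r′≤q′ p≤q′+r′ 2≤p)
      ; lower′ = ≤-cong (trans (cong₂ ℤ._+_ (pos-∸ q′≤p) (pos-∸ r′≤q′)) (trans (lem₄ (+ q′) (+ r′) (+ p)) (sym (pos-∸ r′≤p))))
                   (lower₂′ n n<N r′≤q′ p≤q′+r′)
      })
      where
      r′≤q′ : r′ ℕ.≤ q′
      r′≤q′ = ℕₚ.∸-cancelʳ-≤ r′≤p (subst (ℕ._≤ p ℕ.∸ r′) α≡p-q′ α≤p-r′)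
      p≤q′+r′ : p ℕ.≤ q′ ℕ.+ r′
      p≤q′+r′ = ℕₚ.≤-trans (ℕₚ.m≤n+m∸n p q′) (ℕₚ.+-monoʳ-≤ q′ (subst (ℕ._≤ r′) α≡p-q′ α≤r′))
      lem₁ : ∀ α β → α ℤ.+ (α ℤ.+ β) ≡ (α ℤ.+ (α ℤ.+ + 0)) ℤ.+ β
      lem₁ = solve-∀
      lem₂ : ∀ q′ r′ p → (p ℤ.- q′) ℤ.+ ((q′ ℤ.+ r′) ℤ.- p) ≡ p ℤ.- (p ℤ.- r′)
      lem₂ = solve-∀
      lem₃ : ∀ α r′ p → α ℤ.+ (α ℤ.+ r′) ≡ p ℤ.+ (α ℤ.+ (α ℤ.+ + 0)) ℤ.- (p ℤ.- r′)
      lem₃ = solve-∀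
      lem₄ : ∀ q′ r′ p → (p ℤ.- q′) ℤ.+ (q′ ℤ.- r′) ≡ p ℤ.- r′
      lem₄ = solve-∀

  coefficient-bounds : α ≡ q′ ⊎ α ≡ p ℕ.∸ q′ → ∀ n → WithinBounds p α β (a n)
  coefficient-bounds α≡ n with n ℕₚ.<? p ℕ.* q ℕ.* r
  ... | no n≮N = subst (WithinBounds p α β)
        (sym (coefficients-beyond p-prime q-prime r-prime p≢q p≢r q≢r ζ isPrimitive a a-coefficients n (ℕₚ.≮⇒≥ n≮N)))
        (0-withinBounds (ℕₚ.<⇒≤ β<p))
  ... | yes n<N = subst (WithinBounds p α β)
        (sym (coefficients-determined p-prime q-prime r-prime p≢q p≢r q≢r ζ isPrimitive a a-coefficients A A-causal A-generating n n<N))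
        (A-bounds α≡)
    where
    +n<N : + n ℤ.< N
    +n<N = subst (+ n ℤ.<_) (sym N≡) (ℤ.+<+ n<N)
    A-bounds : α ≡ q′ ⊎ α ≡ p ℕ.∸ q′ → WithinBounds p α β (A (+ n))
    A-bounds (inj₁ α≡q′)   = near α≡q′ (+ n) +n<N
    A-bounds (inj₂ α≡p-q′) = far α≡p-q′ (+ n) +n<N

theorem1 : ∀ {c ℓ₁ ℓ₂} (K : HeytingField c ℓ₁ ℓ₂) → CharacteristicZero K →
    (p q r : ℕ) → Prime p → Prime q → Prime r →
    p ≢ q → p ≢ r → q ≢ r → p ℕ.< q → p ℕ.< r →
    (ζ : HeytingField.Carrier K) → IsPrimitiveRoot K (p ℕ.* q ℕ.* r) ζ →
    (a : ℕ → ℤ) → HasIntegerCoefficients K (Φ K (p ℕ.* q ℕ.* r) ζ) a →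
    (A₊ A₋ : ℤ) → IsMaxOf a A₊ → IsMinOf a A₋ →
    (q′ r′ : ℕ) → IsInverseMod p q q′ → IsInverseMod p r r′ →
    (α : ℕ) → α ≡ q′ ℕ.⊓ r′ ℕ.⊓ (p ℕ.∸ q′) ℕ.⊓ (p ℕ.∸ r′) →
    (β : ℕ) → 0 ℕ.< β → β ℕ.< p → α ℕ.* β ℕ.* q ℕ.* r ≡ 1 [mod p ] →
    (A₊ ℤ.≤ (+ (2 ℕ.* α ℕ.+ β)) ℤ.⊓ (+ p ℤ.- + β))
    × (ℤ.- A₋ ℤ.≤ (+ p ℤ.+ + (2 ℕ.* α) ℤ.- + β) ℤ.⊓ (+ β))
theorem1 K char0 p q r p-prime q-prime r-prime p≢q p≢r q≢r _ _ ζ isPrimitive a a-coefficients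
  A₊ A₋ ((n₊ , refl) , _) ((n₋ , refl) , _) q′ r′ q-inv r-inv α α≡ β _ β<p αβ =
  ℤₚ.⊓-glb (upper (bounds n₊)) (upper′ (bounds n₊)) , ℤₚ.⊓-glb (lower (bounds n₋)) (lower′ (bounds n₋))
  where
  open WithinBounds

  α≤₃ : α ℕ.≤ q′ ℕ.⊓ r′ ℕ.⊓ (p ℕ.∸ q′)
  α≤₃ = ℕₚ.≤-trans (ℕₚ.≤-reflexive α≡) (ℕₚ.m⊓n≤m _ (p ℕ.∸ r′))
  α≤p-r′ : α ℕ.≤ p ℕ.∸ r′
  α≤p-r′ = ℕₚ.≤-trans (ℕₚ.≤-reflexive α≡) (ℕₚ.m⊓n≤n (q′ ℕ.⊓ r′ ℕ.⊓ (p ℕ.∸ q′)) _)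
  α≤p-q′ : α ℕ.≤ p ℕ.∸ q′
  α≤p-q′ = ℕₚ.≤-trans α≤₃ (ℕₚ.m⊓n≤n (q′ ℕ.⊓ r′) _)
  α≤q′ : α ℕ.≤ q′
  α≤q′ = ℕₚ.≤-trans α≤₃ (ℕₚ.≤-trans (ℕₚ.m⊓n≤m _ (p ℕ.∸ q′)) (ℕₚ.m⊓n≤m q′ r′))
  α≤r′ : α ℕ.≤ r′
  α≤r′ = ℕₚ.≤-trans α≤₃ (ℕₚ.≤-trans (ℕₚ.m⊓n≤m _ (p ℕ.∸ q′)) (ℕₚ.m⊓n≤n q′ r′))

  attained : (α ≡ q′ ⊎ α ≡ p ℕ.∸ q′) ⊎ (α ≡ r′ ⊎ α ≡ p ℕ.∸ r′)
  attained with ℕₚ.⊓-sel (q′ ℕ.⊓ r′ ℕ.⊓ (p ℕ.∸ q′)) (p ℕ.∸ r′)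
  ... | inj₂ e = inj₂ (inj₂ (trans α≡ e))
  ... | inj₁ e with ℕₚ.⊓-sel (q′ ℕ.⊓ r′) (p ℕ.∸ q′)
  ... | inj₂ e′ = inj₁ (inj₂ (trans α≡ (trans e e′)))
  ... | inj₁ e′ with ℕₚ.⊓-sel q′ r′
  ... | inj₁ e″ = inj₁ (inj₁ (trans α≡ (trans e (trans e′ e″))))
  ... | inj₂ e″ = inj₂ (inj₁ (trans α≡ (trans e (trans e′ e″))))

  swap-* : ∀ x → x ℕ.* q ℕ.* r ≡ x ℕ.* r ℕ.* q
  swap-* x = trans (ℕₚ.*-assoc x q r) (trans (cong (x ℕ.*_) (ℕₚ.*-comm q r)) (sym (ℕₚ.*-assoc x r q)))

  bounds : ∀ n → WithinBounds p α β (a n)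
  bounds with attained
  ... | inj₁ at-q = coefficient-bounds K char0 p-prime q-prime r-prime p≢q p≢r q≢r ζ isPrimitive a a-coefficients
        q-inv r-inv β<p αβ α≤r′ α≤p-r′ at-q
  -- When α comes from r′, the roles of q and r are exchanged; only the order of the factors in pqr
  -- and in the congruence has to be rewritten.
  ... | inj₂ at-r = coefficient-bounds K char0 p-prime r-prime q-prime p≢r p≢q (λ r≡q → q≢r (sym r≡q)) ζ
        (subst (λ N → IsPrimitiveRoot K N ζ) (swap-* p) isPrimitive) a
        (subst (λ N → HasIntegerCoefficients K (Φ K N ζ) a) (swap-* p) a-coefficients)
        r-inv q-inv β<p (subst (λ x → x ≡ 1 [mod p ]) (swap-* (α ℕ.* β)) αβ) α≤q′ α≤p-q′ at-r
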